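{- There is an absolute constant $c>0$ such that for all $\varepsilon,\delta\in(0,1)$ and every positive integer $m< c\,\varepsilon^{ -1}\delta^{ -1}$, there exists a finite multiset $A$ of points in $\mathbb{R}^d$ such that, if $S$ consists of $m$ points drawn independently and uniformly at random from $A$, then the empirical mean $\hat\mu=\frac1m\sum_{p\in S}p$ fails to be a $(1+\varepsilon)$-approximate mean of $A$ with probability greater than $\delta$. In other words, $\Omega(\varepsilon^{ -1}\delta^{ -1})$ independently sampled points are required for the empirical mean to be a $(1+\varepsilon)$-approximate mean with probability at least $1-\delta$ on every instance.
   Context: For a finite multiset $A\subset\mathbb{R}^d$, let $\mathrm{Opt}=\min_{x\in\mathbb{R}^d}\sum_{p\in A}\|p-x\|^2$. A point $x$ is a $(1+\varepsilon)$-approximate mean of $A$ if $\sum_{p\in A}\|p-x\|^2\le(1+\varepsilon)\mathrm{Opt}$. -}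

module Defs where

open import Level using (0ℓ)
open import Data.Nat as ℕ using (ℕ; zero; suc; NonZero)
import Data.Nat.Properties as ℕ
open import Data.Integer using (+_)
open import Data.Rational as ℚ using (ℚ; 0ℚ; 1ℚ; ∣_∣)
import Data.Rational.Properties as ℚ
open import Data.Rational.Solver using (module +-*-Solver)
open import Data.Fin using (Fin)
open import Data.List as List using (List; []; _∷_)
open import Data.Vec as Vec using (Vec; []; _∷_)
open import Data.Vec.Functional as Vector using (Vector)
open import Data.Product using (Σ-syntax; ∃-syntax; _×_; _,_)
open import Relation.Unary using (Pred; Decidable; _⊆_)
open import Relation.Binary.PropositionalEquality

------------------------------------------------------------------------
-- The reals, as Cauchy sequences of rationals under the equality _≃_

IsCauchy : (ℕ → ℚ) → Set
IsCauchy x = ∀ η → 0ℚ ℚ.< η →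
  ∃[ N ] ∀ i j → N ℕ.≤ i → N ℕ.≤ j → ∣ x i ℚ.- x j ∣ ℚ.< η

record ℝ : Set where
  constructor mkℝ
  field
    seq    : ℕ → ℚ
    cauchy : IsCauchy seq

open ℝ public

infix 4 _≃_ _≤_ _<_

record _≃_ (x y : ℝ) : Set where
  constructor mk≃
  field
    close : ∀ η → 0ℚ ℚ.< η → ∃[ N ] ∀ i → N ℕ.≤ i → ∣ seq x i ℚ.- seq y i ∣ ℚ.< η

record _≤_ (x y : ℝ) : Set where
  constructor mk≤
  field
    bound : ∀ η → 0ℚ ℚ.< η → ∃[ N ] ∀ i → N ℕ.≤ i → seq x i ℚ.≤ seq y i ℚ.+ η

record _<_ (x y : ℝ) : Set where
  constructor mk<
  field
    gap       : ℚ
    gap-pos   : 0ℚ ℚ.< gap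
    separated : ∃[ N ] ∀ i → N ℕ.≤ i → seq x i ℚ.+ gap ℚ.≤ seq y i

private
  open +-*-Solver

  halve : ∀ η → ℚ.½ ℚ.* η ℚ.+ ℚ.½ ℚ.* η ≡ η
  halve η = trans (sym (ℚ.*-distribʳ-+ η ℚ.½ ℚ.½)) (ℚ.*-identityˡ η)

  *-pos : ∀ {p q} → 0ℚ ℚ.< p → 0ℚ ℚ.< q → 0ℚ ℚ.< p ℚ.* q
  *-pos {p} {q} 0<p 0<q =
    ℚ.positive⁻¹ _ {{ℚ.pos*pos⇒pos p {{ℚ.positive 0<p}} q {{ℚ.positive 0<q}}}}

  half-pos : ∀ {η} → 0ℚ ℚ.< η → 0ℚ ℚ.< ℚ.½ ℚ.* η
  half-pos = *-pos (ℚ.positive⁻¹ ℚ.½)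

  shrink : ∀ {B η} → 0ℚ ℚ.< B → 0ℚ ℚ.< η → Σ[ θ ∈ ℚ ] 0ℚ ℚ.< θ × B ℚ.* θ ≡ η
  shrink {B} {η} 0<B 0<η =
      r ℚ.* η
    , ℚ.positive⁻¹ _ {{ℚ.pos*pos⇒pos r {{ℚ.1/pos⇒pos B}} η {{ℚ.positive 0<η}}}}
    , (begin
        B ℚ.* (r ℚ.* η)  ≡⟨ sym (ℚ.*-assoc B r η) ⟩
        B ℚ.* r ℚ.* η    ≡⟨ cong (ℚ._* η) (ℚ.*-inverseʳ B) ⟩
        1ℚ ℚ.* η         ≡⟨ ℚ.*-identityˡ η ⟩
        η                ∎)
    where
    open ≡-Reasoning
    instance
      B-pos : ℚ.Positive B
      B-pos = ℚ.positive 0<B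
      B-nonZero : ℚ.NonZero B
      B-nonZero = ℚ.pos⇒nonZero B
    r = ℚ.1/ B

  *-mono-≤-nonNeg : ∀ {a b c d} → 0ℚ ℚ.≤ c → 0ℚ ℚ.≤ b → a ℚ.≤ b → c ℚ.≤ d →
                    a ℚ.* c ℚ.≤ b ℚ.* d
  *-mono-≤-nonNeg {a} {b} {c} {d} 0≤c 0≤b a≤b c≤d = ℚ.≤-trans
    (ℚ.*-monoʳ-≤-nonNeg c {{ℚ.nonNegative 0≤c}} a≤b)
    (ℚ.*-monoˡ-≤-nonNeg b {{ℚ.nonNegative 0≤b}} c≤d)

  bounded : ∀ x → IsCauchy x →
            Σ[ B ∈ ℚ ] 0ℚ ℚ.< B × ∃[ N ] ∀ i → N ℕ.≤ i → ∣ x i ∣ ℚ.≤ B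
  bounded x cx with cx 1ℚ (ℚ.positive⁻¹ 1ℚ)
  ... | N , close = B , 0<B , N , λ i N≤i → begin
      ∣ x i ∣                        ≡⟨ cong ∣_∣ (split (x i) (x N)) ⟩
      ∣ (x i ℚ.- x N) ℚ.+ x N ∣      ≤⟨ ℚ.∣p+q∣≤∣p∣+∣q∣ (x i ℚ.- x N) (x N) ⟩
      ∣ x i ℚ.- x N ∣ ℚ.+ ∣ x N ∣    ≤⟨ ℚ.+-monoˡ-≤ ∣ x N ∣ (ℚ.<⇒≤ (close i N N≤i ℕ.≤-refl)) ⟩
      B                              ∎
    where
    open ℚ.≤-Reasoning
    B = 1ℚ ℚ.+ ∣ x N ∣
    0<B : 0ℚ ℚ.< B
    0<B = ℚ.+-mono-<-≤ (ℚ.positive⁻¹ 1ℚ) (ℚ.0≤∣p∣ (x N))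
    split : ∀ a b → a ≡ (a ℚ.- b) ℚ.+ b
    split = solve 2 (λ a b → a := (a :- b) :+ b) refl

  const-cauchy : ∀ q → IsCauchy (λ _ → q)
  const-cauchy q η 0<η = 0 , λ _ _ _ _ →
    subst (λ z → ∣ z ∣ ℚ.< η) (sym (ℚ.+-inverseʳ q)) 0<η

  +-cauchy : ∀ x y → IsCauchy x → IsCauchy y → IsCauchy (λ i → x i ℚ.+ y i)
  +-cauchy x y cx cy η 0<η
    with cx (ℚ.½ ℚ.* η) (half-pos 0<η) | cy (ℚ.½ ℚ.* η) (half-pos 0<η)
  ... | M , hx | N , hy = M ℕ.⊔ N , λ i j i≥ j≥ → begin-strict
      ∣ (x i ℚ.+ y i) ℚ.- (x j ℚ.+ y j) ∣      ≡⟨ cong ∣_∣ (regroup (x i) (y i) (x j) (y j)) ⟩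
      ∣ (x i ℚ.- x j) ℚ.+ (y i ℚ.- y j) ∣      ≤⟨ ℚ.∣p+q∣≤∣p∣+∣q∣ (x i ℚ.- x j) (y i ℚ.- y j) ⟩
      ∣ x i ℚ.- x j ∣ ℚ.+ ∣ y i ℚ.- y j ∣      <⟨ ℚ.+-mono-<
        (hx i j (ℕ.m⊔n≤o⇒m≤o M N i≥) (ℕ.m⊔n≤o⇒m≤o M N j≥))
        (hy i j (ℕ.m⊔n≤o⇒n≤o M N i≥) (ℕ.m⊔n≤o⇒n≤o M N j≥)) ⟩
      ℚ.½ ℚ.* η ℚ.+ ℚ.½ ℚ.* η                  ≡⟨ halve η ⟩
      η                                        ∎
    where
    open ℚ.≤-Reasoning
    regroup : ∀ a b c d → (a ℚ.+ b) ℚ.- (c ℚ.+ d) ≡ (a ℚ.- c) ℚ.+ (b ℚ.- d)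
    regroup = solve 4 (λ a b c d → (a :+ b) :- (c :+ d) := (a :- c) :+ (b :- d)) refl

  neg-cauchy : ∀ x → IsCauchy x → IsCauchy (λ i → ℚ.- x i)
  neg-cauchy x cx η 0<η with cx η 0<η
  ... | N , h = N , λ i j i≥ j≥ →
      subst (ℚ._< η) (trans (sym (ℚ.∣-p∣≡∣p∣ _)) (cong ∣_∣ (flip (x i) (x j)))) (h i j i≥ j≥)
    where
    flip : ∀ a b → ℚ.- (a ℚ.- b) ≡ (ℚ.- a) ℚ.- (ℚ.- b)
    flip = solve 2 (λ a b → :- (a :- b) := (:- a) :- (:- b)) refl

  ∣*-*∣≤ : ∀ a b c d → ∣ a ℚ.* b ℚ.- c ℚ.* d ∣ ℚ.≤
                       ∣ a ∣ ℚ.* ∣ b ℚ.- d ∣ ℚ.+ ∣ d ∣ ℚ.* ∣ a ℚ.- c ∣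
  ∣*-*∣≤ a b c d = begin
      ∣ a ℚ.* b ℚ.- c ℚ.* d ∣                              ≡⟨ cong ∣_∣ (regroup a b c d) ⟩
      ∣ a ℚ.* (b ℚ.- d) ℚ.+ d ℚ.* (a ℚ.- c) ∣              ≤⟨ ℚ.∣p+q∣≤∣p∣+∣q∣ (a ℚ.* (b ℚ.- d)) (d ℚ.* (a ℚ.- c)) ⟩
      ∣ a ℚ.* (b ℚ.- d) ∣ ℚ.+ ∣ d ℚ.* (a ℚ.- c) ∣          ≡⟨ cong₂ ℚ._+_ (ℚ.∣p*q∣≡∣p∣*∣q∣ a (b ℚ.- d)) (ℚ.∣p*q∣≡∣p∣*∣q∣ d (a ℚ.- c)) ⟩
      ∣ a ∣ ℚ.* ∣ b ℚ.- d ∣ ℚ.+ ∣ d ∣ ℚ.* ∣ a ℚ.- c ∣      ∎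
    where
    open ℚ.≤-Reasoning
    regroup : ∀ a b c d → a ℚ.* b ℚ.- c ℚ.* d ≡ a ℚ.* (b ℚ.- d) ℚ.+ d ℚ.* (a ℚ.- c)
    regroup = solve 4 (λ a b c d → a :* b :- c :* d := a :* (b :- d) :+ d :* (a :- c)) refl

  *-mono-≤-< : ∀ {p B t θ} → 0ℚ ℚ.< B → 0ℚ ℚ.≤ t → p ℚ.≤ B → t ℚ.< θ → p ℚ.* t ℚ.< B ℚ.* θ
  *-mono-≤-< {p} {B} {t} {θ} 0<B 0≤t p≤B t<θ = ℚ.≤-<-trans
    (ℚ.*-monoʳ-≤-nonNeg t {{ℚ.nonNegative 0≤t}} p≤B)
    (ℚ.*-monoʳ-<-pos B {{ℚ.positive 0<B}} t<θ)

  *-cauchy : ∀ x y → IsCauchy x → IsCauchy y → IsCauchy (λ i → x i ℚ.* y i)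
  *-cauchy x y cx cy η 0<η =
    let B , 0<B , M₁ , bx = bounded x cx
        C , 0<C , N₁ , by = bounded y cy
        θ , 0<θ , Bθ = shrink 0<B (half-pos 0<η)
        ζ , 0<ζ , Cζ = shrink 0<C (half-pos 0<η)
        M₂ , hx = cx ζ 0<ζ
        N₂ , hy = cy θ 0<θ
        K₁ = M₁ ℕ.⊔ N₁
        K₂ = M₂ ℕ.⊔ N₂
    in K₁ ℕ.⊔ K₂ , λ i j i≥ j≥ →
      let i≥₁ = ℕ.m⊔n≤o⇒m≤o K₁ K₂ i≥
          i≥₂ = ℕ.m⊔n≤o⇒n≤o K₁ K₂ i≥
          j≥₁ = ℕ.m⊔n≤o⇒m≤o K₁ K₂ j≥
          j≥₂ = ℕ.m⊔n≤o⇒n≤o K₁ K₂ j≥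
      in ℚ.≤-<-trans (∣*-*∣≤ (x i) (y i) (x j) (y j))
           (subst (_ ℚ.<_) (trans (cong₂ ℚ._+_ Bθ Cζ) (halve η))
             (ℚ.+-mono-<
               (*-mono-≤-< 0<B (ℚ.0≤∣p∣ (y i ℚ.- y j)) (bx i (ℕ.m⊔n≤o⇒m≤o M₁ N₁ i≥₁))
                 (hy i j (ℕ.m⊔n≤o⇒n≤o M₂ N₂ i≥₂) (ℕ.m⊔n≤o⇒n≤o M₂ N₂ j≥₂)))
               (*-mono-≤-< 0<C (ℚ.0≤∣p∣ (x i ℚ.- x j)) (by j (ℕ.m⊔n≤o⇒n≤o M₁ N₁ j≥₁))
                 (hx i j (ℕ.m⊔n≤o⇒m≤o M₂ N₂ i≥₂) (ℕ.m⊔n≤o⇒m≤o M₂ N₂ j≥₂)))))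

  ⊔-nonZero : ∀ {η} → 0ℚ ℚ.< η → ∀ q → ℚ.NonZero (η ℚ.⊔ q)
  ⊔-nonZero {η} 0<η q =
    ℚ.pos⇒nonZero (η ℚ.⊔ q) {{ℚ.positive (ℚ.<-≤-trans 0<η (ℚ.p≤p⊔q η q))}}

1/max : ∀ {η} → 0ℚ ℚ.< η → ℚ → ℚ
1/max {η} 0<η q = (ℚ.1/ (η ℚ.⊔ q)) {{⊔-nonZero 0<η q}}

private
  1/max-pos : ∀ {η} (0<η : 0ℚ ℚ.< η) q → 0ℚ ℚ.< 1/max 0<η q
  1/max-pos {η} 0<η q = ℚ.positive⁻¹ _ {{ℚ.1/pos⇒pos (η ℚ.⊔ q)
    {{ℚ.positive (ℚ.<-≤-trans 0<η (ℚ.p≤p⊔q η q))}}}}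

  1/max-inverse : ∀ {η} (0<η : 0ℚ ℚ.< η) q → η ℚ.≤ q → 1/max 0<η q ℚ.* q ≡ 1ℚ
  1/max-inverse {η} 0<η q η≤q = trans
    (cong (1/max 0<η q ℚ.*_) (sym (ℚ.p≤q⇒p⊔q≡q η≤q)))
    (ℚ.*-inverseˡ (η ℚ.⊔ q) {{⊔-nonZero 0<η q}})

  recip-antimono : ∀ u v a b → 0ℚ ℚ.< u → 0ℚ ℚ.< v → u ℚ.* a ≡ 1ℚ → v ℚ.* b ≡ 1ℚ →
                   b ℚ.≤ a → u ℚ.≤ v
  recip-antimono u v a b 0<u 0<v ua vb b≤a = begin
    u                  ≡⟨ ℚ.*-identityʳ u ⟨
    u ℚ.* 1ℚ           ≡⟨ cong (u ℚ.*_) (trans (ℚ.*-comm b v) vb) ⟨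
    u ℚ.* (b ℚ.* v)    ≤⟨ ℚ.*-monoˡ-≤-nonNeg u {{ℚ.nonNegative (ℚ.<⇒≤ 0<u)}}
                            (ℚ.*-monoʳ-≤-nonNeg v {{ℚ.nonNegative (ℚ.<⇒≤ 0<v)}} b≤a) ⟩
    u ℚ.* (a ℚ.* v)    ≡⟨ ℚ.*-assoc u a v ⟨
    u ℚ.* a ℚ.* v      ≡⟨ cong (ℚ._* v) ua ⟩
    1ℚ ℚ.* v           ≡⟨ ℚ.*-identityˡ v ⟩
    v                  ∎
    where open ℚ.≤-Reasoning

  recip-diff : ∀ v w a b → v ℚ.* a ≡ 1ℚ → w ℚ.* b ≡ 1ℚ →
               v ℚ.- w ≡ (v ℚ.* w) ℚ.* (b ℚ.- a)
  recip-diff v w a b va wb = sym (trans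
    (solve 4 (λ a b v w → (v :* w) :* (b :- a) := v :* (w :* b) :- w :* (v :* a)) refl a b v w)
    (cong₂ ℚ._-_ (trans (cong (v ℚ.*_) wb) (ℚ.*-identityʳ v))
                 (trans (cong (w ℚ.*_) va) (ℚ.*-identityʳ w))))

  recip-close : ∀ u v w a b θ → 0ℚ ℚ.< u → 0ℚ ℚ.< v → 0ℚ ℚ.< w →
                v ℚ.* a ≡ 1ℚ → w ℚ.* b ≡ 1ℚ → v ℚ.≤ u → w ℚ.≤ u →
                ∣ b ℚ.- a ∣ ℚ.< θ → ∣ v ℚ.- w ∣ ℚ.< (u ℚ.* u) ℚ.* θ
  recip-close u v w a b θ 0<u 0<v 0<w va wb v≤u w≤u h = subst (ℚ._< (u ℚ.* u) ℚ.* θ)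
    (sym (trans (cong ∣_∣ (recip-diff v w a b va wb))
      (trans (ℚ.∣p*q∣≡∣p∣*∣q∣ (v ℚ.* w) (b ℚ.- a))
        (cong (ℚ._* ∣ b ℚ.- a ∣) (ℚ.0≤p⇒∣p∣≡p (ℚ.<⇒≤ (*-pos 0<v 0<w)))))))
    (*-mono-≤-< (*-pos 0<u 0<u) (ℚ.0≤∣p∣ (b ℚ.- a))
      (*-mono-≤-nonNeg (ℚ.<⇒≤ 0<w) (ℚ.<⇒≤ 0<u) v≤u w≤u) h)

  1/max-cauchy : ∀ x η (0<η : 0ℚ ℚ.< η) → IsCauchy x →
                 (∃[ N ] ∀ i → N ℕ.≤ i → η ℚ.≤ x i) →
                 IsCauchy (λ i → 1/max 0<η (x i))
  1/max-cauchy x q 0<q cx (N₁ , q≤x) η 0<η =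
    let u = 1/max 0<q
        0<r = 1/max-pos 0<q q
        rq = 1/max-inverse 0<q q ℚ.≤-refl
        θ , 0<θ , rrθ = shrink (*-pos 0<r 0<r) 0<η
        N₂ , hx = cx θ 0<θ
        inverse : ∀ i → N₁ ℕ.⊔ N₂ ℕ.≤ i → u (x i) ℚ.* x i ≡ 1ℚ
        inverse i i≥ = 1/max-inverse 0<q (x i) (q≤x i (ℕ.m⊔n≤o⇒m≤o N₁ N₂ i≥))
        bound : ∀ i → N₁ ℕ.⊔ N₂ ℕ.≤ i → u (x i) ℚ.≤ u q
        bound i i≥ = recip-antimono (u (x i)) (u q) (x i) q (1/max-pos 0<q (x i)) 0<r (inverse i i≥) rq
                       (q≤x i (ℕ.m⊔n≤o⇒m≤o N₁ N₂ i≥))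
    in N₁ ℕ.⊔ N₂ , λ i j i≥ j≥ →
      subst (∣ u (x i) ℚ.- u (x j) ∣ ℚ.<_) rrθ
        (recip-close (u q) (u (x i)) (u (x j)) (x i) (x j) θ 0<r (1/max-pos 0<q (x i)) (1/max-pos 0<q (x j))
          (inverse i i≥) (inverse j j≥) (bound i i≥) (bound j j≥)
          (hx j i (ℕ.m⊔n≤o⇒n≤o N₁ N₂ j≥) (ℕ.m⊔n≤o⇒n≤o N₁ N₂ i≥)))

infixl 6 _+_ _-_
infixl 7 _*_
infix  8 -_

fromℚ : ℚ → ℝ
fromℚ q = mkℝ (λ _ → q) (const-cauchy q)

fromℕ : ℕ → ℝ
fromℕ n = fromℚ (+ n ℚ./ 1)

0ℝ 1ℝ : ℝ
0ℝ = fromℚ 0ℚ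
1ℝ = fromℚ 1ℚ

_+_ : ℝ → ℝ → ℝ
x + y = mkℝ (λ i → seq x i ℚ.+ seq y i) (+-cauchy (seq x) (seq y) (cauchy x) (cauchy y))

-_ : ℝ → ℝ
-_ x = mkℝ (λ i → ℚ.- seq x i) (neg-cauchy (seq x) (cauchy x))

_-_ : ℝ → ℝ → ℝ
_-_ x y = x + (- y)

_*_ : ℝ → ℝ → ℝ
x * y = mkℝ (λ i → seq x i ℚ.* seq y i) (*-cauchy (seq x) (seq y) (cauchy x) (cauchy y))

-- The witness η of 0 < x satisfies η ≤ x i for all large i, so taking the
-- maximum with η alters only finitely many terms.
inv : (x : ℝ) → 0ℝ < x → ℝ
inv x (mk< η 0<η (N , h)) = mkℝ (λ i → 1/max 0<η (seq x i))
  (1/max-cauchy (seq x) η 0<η (cauchy x)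
    (N , λ i N≤i → subst (ℚ._≤ seq x i) (ℚ.+-identityˡ η) (h i N≤i)))

------------------------------------------------------------------------
-- Approximate means
--
-- A finite multiset is given as an indexed family A : Vector (Point d) n;
-- everything below is invariant under permuting the index set.

Point : ℕ → Set
Point d = Vector ℝ d

∑ : ∀ {n} → Vector ℝ n → ℝ
∑ = Vector.foldr _+_ 0ℝ

‖_-_‖² : ∀ {d} → Point d → Point d → ℝ
‖ p - x ‖² = ∑ (λ i → (p i - x i) * (p i - x i))

cost : ∀ {d n} → Vector (Point d) n → Point d → ℝ
cost A x = ∑ (λ a → ‖ A a - x ‖²)

IsOpt : ∀ {d n} → Vector (Point d) n → ℝ → Set
IsOpt {d} A o = (∃[ x ] cost A x ≃ o) × (∀ (x : Point d) → o ≤ cost A x)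

IsApproxMean : ∀ {d n} → ℝ → Vector (Point d) n → Point d → Set
IsApproxMean ε A x = ∃[ Opt ] IsOpt A Opt × cost A x ≤ (1ℝ + ε) * Opt

------------------------------------------------------------------------
-- Independent uniform sampling from Fin n (equivalently, from the n members
-- of A with multiplicity): the uniform distribution on Fin n × ⋯ × Fin n.

Sample : ℕ → ℕ → Set
Sample n m = Vec (Fin n) m

allSamples : ∀ n m → List (Sample n m)
allSamples n zero    = [] ∷ []
allSamples n (suc m) = List.cartesianProductWith _∷_ (List.allFin n) (allSamples n m)

Pr : ∀ {n m} .{{_ : NonZero n}} {F : Pred (Sample n m) 0ℓ} → Decidable F → ℚ
Pr {n} {m} F? =
  (+ List.length (List.filter F? (allSamples n m)) ℚ./ (n ℕ.^ m)) {{ℕ.m^n≢0 n m}}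

-- Events defined by inequalities between reals need not be decidable, so "E has
-- probability greater than δ" is read as: E contains a decidable event of
-- probability greater than δ.  For decidable E this is just δ < Pr E.
Pr[_]>_ : ∀ {n m} .{{_ : NonZero n}} → Pred (Sample n m) 0ℓ → ℝ → Set₁
Pr[_]>_ {n} {m} E δ =
  Σ[ F ∈ Pred (Sample n m) 0ℓ ] Σ[ F? ∈ Decidable F ] F ⊆ E × δ < fromℚ (Pr F?)

empiricalMean : ∀ {d n m} .{{_ : NonZero m}} → Vector (Point d) n → Sample n m → Point d
empiricalMean {m = m} A s i = fromℚ (+ 1 ℚ./ m) * ∑ (λ j → A (Vec.lookup s j) i)

{-# OPTIONS --safe #-}

-- A has n = Km points, one at (1,…,1) and the others at the origin, so a sample
-- is determined, up to order, by the number y of times it hits the first one.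
-- With r = 1/n, the cost of (x,…,x) is d(1 - r + n(x - r)²), so the empirical mean,
-- which has x = y/m, fails as soon as n(y/m - r)² ≥ ε.  If y ≥ 1 and K ≥ 2 then
-- y/m - r ≥ 1/(2m), and K ≥ 4εm suffices; if y = 0 then Kεm ≤ 1 suffices.
-- When 2εm ≤ 1, K = 2 makes every sample fail.  Otherwise K = ⌈4εm⌉ makes every
-- sample with y ≥ 1 fail, an event of probability 1 - (1 - 1/n)^m ≥ 1/(K + 1) ≥ 1/(8εm).

module Submission where

open import Defs
open import Data.Nat using (ℕ; suc; NonZero)
open import Data.Product using (Σ-syntax; ∃-syntax; _×_)
open import Data.Vec.Functional using (Vector)
open import Relation.Nullary using (¬_)

open import Data.Bool using (true; false)
open import Data.Fin as Fin using (Fin; zero; suc)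
open import Data.Integer as ℤ using (+_)
import Data.Integer.Properties as ℤ
open import Data.List as List using (List; []; _∷_)
import Data.List.Properties as List
import Data.List.Relation.Unary.All as All
import Data.Nat as ℕ
import Data.Nat.Properties as ℕ
open import Data.Nat.Solver using () renaming (module +-*-Solver to ℕ-Solver)
open import Data.Product using (_,_; proj₁; proj₂)
open import Data.Rational as ℚ using (ℚ; 0ℚ; 1ℚ; ½; ∣_∣)
import Data.Rational.Properties as ℚ
open import Data.Rational.Solver using (module +-*-Solver)
import Data.Rational.Unnormalised as ℚᵘ
import Data.Rational.Unnormalised.Properties as ℚᵘ
open import Data.Sum using (inj₁; inj₂)
open import Data.Unit using (⊤; tt)
open import Data.Vec as Vec using ([]; _∷_)
open import Data.Vec.Relation.Unary.Any using (Any; here; there; any?)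
open import Function using (_∘_)
open import Level using (0ℓ)
open import Relation.Binary.PropositionalEquality
open import Relation.Nullary using (Dec; yes; no; does; contradiction)
open import Relation.Unary using (Pred; Decidable)

open +-*-Solver using (solve; _:=_; _:+_; _:*_; _:-_; con)

-- Order arithmetic in ℚ

*-nonNeg : ∀ {p q} → 0ℚ ℚ.≤ p → 0ℚ ℚ.≤ q → 0ℚ ℚ.≤ p ℚ.* q
*-nonNeg {p} {q} 0≤p 0≤q = ℚ.nonNegative⁻¹ _
  {{ℚ.nonNeg*nonNeg⇒nonNeg p {{ℚ.nonNegative 0≤p}} q {{ℚ.nonNegative 0≤q}}}}

*-pos : ∀ {p q} → 0ℚ ℚ.< p → 0ℚ ℚ.< q → 0ℚ ℚ.< p ℚ.* q
*-pos {p} {q} 0<p 0<q = ℚ.positive⁻¹ _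
  {{ℚ.pos*pos⇒pos p {{ℚ.positive 0<p}} q {{ℚ.positive 0<q}}}}

*-cancelˡ-pos : ∀ p {q} → 0ℚ ℚ.< p → 0ℚ ℚ.< p ℚ.* q → 0ℚ ℚ.< q
*-cancelˡ-pos p {q} 0<p 0<pq = ℚ.*-cancelˡ-<-nonNeg p {{ℚ.nonNegative (ℚ.<⇒≤ 0<p)}}
  (subst (ℚ._< p ℚ.* q) (sym (ℚ.*-zeroʳ p)) 0<pq)

0≤q-p⇒p≤q : ∀ {p q} → 0ℚ ℚ.≤ q ℚ.- p → p ℚ.≤ q
0≤q-p⇒p≤q {p} {q} 0≤q-p = subst₂ ℚ._≤_ (ℚ.+-identityˡ p)
  (solve 2 (λ p q → (q :- p) :+ p := q) refl p q) (ℚ.+-monoˡ-≤ p 0≤q-p)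

p≤q⇒0≤q-p : ∀ {p q} → p ℚ.≤ q → 0ℚ ℚ.≤ q ℚ.- p
p≤q⇒0≤q-p {p} {q} p≤q = subst (ℚ._≤ q ℚ.- p) (ℚ.+-inverseʳ p) (ℚ.+-monoˡ-≤ (ℚ.- p) p≤q)

0<q-p⇒p<q : ∀ {p q} → 0ℚ ℚ.< q ℚ.- p → p ℚ.< q
0<q-p⇒p<q {p} {q} 0<q-p = subst₂ ℚ._<_ (ℚ.+-identityˡ p)
  (solve 2 (λ p q → (q :- p) :+ p := q) refl p q) (ℚ.+-monoˡ-< p 0<q-p)

p<q⇒0<q-p : ∀ {p q} → p ℚ.< q → 0ℚ ℚ.< q ℚ.- p
p<q⇒0<q-p {p} {q} p<q = subst (ℚ._< q ℚ.- p) (ℚ.+-inverseʳ p) (ℚ.+-monoˡ-< (ℚ.- p) p<q)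

p≤∣p∣ : ∀ p → p ℚ.≤ ∣ p ∣
p≤∣p∣ p with ℚ.≤-total 0ℚ p
... | inj₁ 0≤p = ℚ.≤-reflexive (sym (ℚ.0≤p⇒∣p∣≡p 0≤p))
... | inj₂ p≤0 = ℚ.≤-trans p≤0 (ℚ.0≤∣p∣ p)

divide : ∀ {B η} → 0ℚ ℚ.< B → 0ℚ ℚ.< η → Σ[ θ ∈ ℚ ] 0ℚ ℚ.< θ × B ℚ.* θ ≡ η
divide {B} {η} 0<B 0<η = θ , *-cancelˡ-pos B 0<B (subst (0ℚ ℚ.<_) (sym Bθ≡η) 0<η) , Bθ≡η
  where
  instance
    B-nonZero : ℚ.NonZero B
    B-nonZero = ℚ.pos⇒nonZero B {{ℚ.positive 0<B}}
  θ = ℚ.1/ B ℚ.* η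
  Bθ≡η : B ℚ.* θ ≡ η
  Bθ≡η = trans (sym (ℚ.*-assoc B (ℚ.1/ B) η))
    (trans (cong (ℚ._* η) (ℚ.*-inverseʳ B)) (ℚ.*-identityˡ η))

-- Natural numbers inside ℚ, and ceilings

ι : ℕ → ℚ
ι n = + n ℚ./ 1

toℚᵘ-ι : ∀ n → ℚ.toℚᵘ (ι n) ℚᵘ.≃ ℚᵘ.mkℚᵘ (+ n) 0
toℚᵘ-ι n = ℚ.toℚᵘ-fromℚᵘ (ℚᵘ.mkℚᵘ (+ n) 0)

ι-+ : ∀ a b → ι (a ℕ.+ b) ≡ ι a ℚ.+ ι b
ι-+ a b = ℚ.toℚᵘ-injective (begin
  ℚ.toℚᵘ (ι (a ℕ.+ b))                      ≈⟨ toℚᵘ-ι (a ℕ.+ b) ⟩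
  ℚᵘ.mkℚᵘ (+ (a ℕ.+ b)) 0                   ≈⟨ ℚᵘ.*≡* (cong (ℤ._* (+ 1)) (sym (cong₂ ℤ._+_ (ℤ.*-identityʳ (+ a)) (ℤ.*-identityʳ (+ b))))) ⟩
  ℚᵘ.mkℚᵘ (+ a) 0 ℚᵘ.+ ℚᵘ.mkℚᵘ (+ b) 0      ≈⟨ ℚᵘ.+-cong (toℚᵘ-ι a) (toℚᵘ-ι b) ⟨
  ℚ.toℚᵘ (ι a) ℚᵘ.+ ℚ.toℚᵘ (ι b)            ≈⟨ ℚ.toℚᵘ-homo-+ (ι a) (ι b) ⟨
  ℚ.toℚᵘ (ι a ℚ.+ ι b)                      ∎)
  where open ℚᵘ.≃-Reasoning

ι-* : ∀ a b → ι (a ℕ.* b) ≡ ι a ℚ.* ι b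
ι-* a b = ℚ.toℚᵘ-injective (begin
  ℚ.toℚᵘ (ι (a ℕ.* b))                      ≈⟨ toℚᵘ-ι (a ℕ.* b) ⟩
  ℚᵘ.mkℚᵘ (+ (a ℕ.* b)) 0                   ≈⟨ ℚᵘ.*≡* (cong (ℤ._* (+ 1)) (ℤ.pos-* a b)) ⟩
  ℚᵘ.mkℚᵘ (+ a) 0 ℚᵘ.* ℚᵘ.mkℚᵘ (+ b) 0      ≈⟨ ℚᵘ.*-cong (toℚᵘ-ι a) (toℚᵘ-ι b) ⟨
  ℚ.toℚᵘ (ι a) ℚᵘ.* ℚ.toℚᵘ (ι b)            ≈⟨ ℚ.toℚᵘ-homo-* (ι a) (ι b) ⟨
  ℚ.toℚᵘ (ι a ℚ.* ι b)                      ∎)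
  where open ℚᵘ.≃-Reasoning

ι-mono-≤ : ∀ {a b} → a ℕ.≤ b → ι a ℚ.≤ ι b
ι-mono-≤ {a} {b} a≤b = ℚ.toℚᵘ-cancel-≤
  (ℚᵘ.≤-respˡ-≃ (ℚᵘ.≃-sym (toℚᵘ-ι a)) (ℚᵘ.≤-respʳ-≃ (ℚᵘ.≃-sym (toℚᵘ-ι b))
    (ℚᵘ.*≤* (ℤ.*-monoʳ-≤-nonNeg (+ 1) (ℤ.+≤+ a≤b)))))

0≤ι : ∀ n → 0ℚ ℚ.≤ ι n
0≤ι n = ι-mono-≤ {0} {n} ℕ.z≤n

0<ι : ∀ n .{{_ : NonZero n}} → 0ℚ ℚ.< ι n
0<ι (suc n) = ℚ.<-≤-trans (ℚ.positive⁻¹ 1ℚ) (ι-mono-≤ {1} {suc n} (ℕ.s≤s ℕ.z≤n))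

/-*-ι : ∀ a b .{{_ : NonZero b}} → (+ a ℚ./ b) ℚ.* ι b ≡ ι a
/-*-ι a (suc b) = ℚ.toℚᵘ-injective (begin
  ℚ.toℚᵘ ((+ a ℚ./ suc b) ℚ.* ι (suc b))                ≈⟨ ℚ.toℚᵘ-homo-* (+ a ℚ./ suc b) (ι (suc b)) ⟩
  ℚ.toℚᵘ (+ a ℚ./ suc b) ℚᵘ.* ℚ.toℚᵘ (ι (suc b))        ≈⟨ ℚᵘ.*-cong (ℚ.toℚᵘ-fromℚᵘ (ℚᵘ.mkℚᵘ (+ a) b)) (toℚᵘ-ι (suc b)) ⟩
  ℚᵘ.mkℚᵘ (+ a) b ℚᵘ.* ℚᵘ.mkℚᵘ (+ suc b) 0              ≈⟨ ℚᵘ.*≡* (trans (ℤ.*-identityʳ _) (cong (λ k → + a ℤ.* + suc k) (sym (ℕ.*-identityʳ b)))) ⟩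
  ℚᵘ.mkℚᵘ (+ a) 0                                       ≈⟨ toℚᵘ-ι a ⟨
  ℚ.toℚᵘ (ι a)                                          ∎)
  where open ℚᵘ.≃-Reasoning

-- The absolute value of the numerator bounds `q` from above because the denominator is at least 1.
-- Descending from there, the search stops at the first `suc N` whose predecessor lies below `q`.
ceiling : ∀ q → 0ℚ ℚ.< q → ∃[ K ] q ℚ.≤ ι K × ι K ℚ.≤ q ℚ.+ 1ℚ
ceiling q 0<q = descend ℤ.∣ ℚ.↥ q ∣ (bounded q)
  where
  bounded : ∀ q → q ℚ.≤ ι ℤ.∣ ℚ.↥ q ∣
  bounded q@(ℚ.mkℚ n d _) = ℚ.toℚᵘ-cancel-≤ (ℚᵘ.≤-respʳ-≃ (ℚᵘ.≃-sym (toℚᵘ-ι ℤ.∣ n ∣))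
    (ℚᵘ.*≤* (n*1≤ n)))
    where
    n*1≤ : ∀ n → n ℤ.* + 1 ℤ.≤ + ℤ.∣ n ∣ ℤ.* + suc d
    n*1≤ (+ n)        = subst₂ ℤ._≤_ (ℤ.pos-* n 1) (ℤ.pos-* n (suc d)) (ℤ.+≤+ (ℕ.*-monoʳ-≤ n (ℕ.s≤s ℕ.z≤n)))
    n*1≤ (ℤ.-[1+ n ]) = subst (ℤ._≤ + suc n ℤ.* + suc d) (sym (ℤ.*-identityʳ (ℤ.-[1+ n ]))) ℤ.-≤+
  descend : ∀ N → q ℚ.≤ ι N → ∃[ K ] q ℚ.≤ ι K × ι K ℚ.≤ q ℚ.+ 1ℚ
  descend ℕ.zero    q≤0 = contradiction (ℚ.<-≤-trans 0<q q≤0) (ℚ.<-irrefl refl)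
  descend (suc N) q≤ with q ℚ.≤? ι N
  ... | yes q≤ιN = descend N q≤ιN
  ... | no  q≰ιN = suc N , q≤ , (begin
      ι (suc N)      ≡⟨ ι-+ 1 N ⟩
      1ℚ ℚ.+ ι N     ≡⟨ ℚ.+-comm 1ℚ (ι N) ⟩
      ι N ℚ.+ 1ℚ     ≤⟨ ℚ.+-monoˡ-≤ 1ℚ (ℚ.<⇒≤ (ℚ.≰⇒> q≰ιN)) ⟩
      q ℚ.+ 1ℚ       ∎)
    where open ℚ.≤-Reasoning

-- Cost of the spike instance at points with equal coordinates

seq-∑-const : ∀ {n} (v : Vector ℝ n) i {q} → (∀ j → seq (v j) i ≡ q) → seq (∑ v) i ≡ ι n ℚ.* q
seq-∑-const {ℕ.zero} v i {q} v≡q = sym (ℚ.*-zeroˡ q)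
seq-∑-const {suc n}  v i {q} v≡q = begin
  seq (v zero) i ℚ.+ seq (∑ (v ∘ suc)) i    ≡⟨ cong₂ ℚ._+_ (v≡q zero) (seq-∑-const (v ∘ suc) i (v≡q ∘ suc)) ⟩
  q ℚ.+ ι n ℚ.* q                           ≡⟨ solve 2 (λ q n → q :+ n :* q := (con 1ℚ :+ n) :* q) refl q (ι n) ⟩
  (1ℚ ℚ.+ ι n) ℚ.* q                        ≡⟨ cong (ℚ._* q) (ι-+ 1 n) ⟨
  ι (suc n) ℚ.* q                           ∎
  where open ≡-Reasoning

seq-‖-‖²-const : ∀ {d} (p x : Point d) i {a b} → (∀ j → seq (p j) i ≡ a) → (∀ j → seq (x j) i ≡ b) →
                 seq ‖ p - x ‖² i ≡ ι d ℚ.* ((a ℚ.- b) ℚ.* (a ℚ.- b))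
seq-‖-‖²-const p x i p≡a x≡b = seq-∑-const _ i
  (λ j → cong₂ (λ a b → (a ℚ.- b) ℚ.* (a ℚ.- b)) (p≡a j) (x≡b j))

spike : ∀ d k → Vector (Point d) (suc k)
spike d k zero    _ = 1ℝ
spike d k (suc _) _ = 0ℝ

-- The expansion of `D ((1 - y)² + (N - 1) y²)`: one point at distance `1 - y` from `y` in each
-- coordinate, and `N - 1` points at distance `y`.
spikeCost : (D N y : ℚ) → ℚ
spikeCost D N y = D ℚ.* ((1ℚ ℚ.- (y ℚ.+ y)) ℚ.+ N ℚ.* (y ℚ.* y))

-- Real operations act termwise on the representing sequences, so at a fixed index `i` the cost is
-- an exact rational polynomial in `y` and no estimate up to `≃` arises.
seq-cost-spike : ∀ d k (x : Point d) i {y} → (∀ j → seq (x j) i ≡ y) →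
                 seq (cost (spike d k) x) i ≡ spikeCost (ι d) (ι (suc k)) y
seq-cost-spike d k x i {y} x≡y = begin
  seq ‖ spike d k zero - x ‖² i ℚ.+ seq (∑ (λ a → ‖ spike d k (suc a) - x ‖²)) i
    ≡⟨ cong₂ ℚ._+_ (seq-‖-‖²-const (spike d k zero) x i (λ _ → refl) x≡y)
         (seq-∑-const _ i (λ a → seq-‖-‖²-const (spike d k (suc a)) x i (λ _ → refl) x≡y)) ⟩
  ι d ℚ.* ((1ℚ ℚ.- y) ℚ.* (1ℚ ℚ.- y)) ℚ.+ ι k ℚ.* (ι d ℚ.* ((0ℚ ℚ.- y) ℚ.* (0ℚ ℚ.- y)))
    ≡⟨ solve 3 (λ d k y → d :* ((con 1ℚ :- y) :* (con 1ℚ :- y)) :+ k :* (d :* ((con 0ℚ :- y) :* (con 0ℚ :- y)))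
         := d :* ((con 1ℚ :- (y :+ y)) :+ (con 1ℚ :+ k) :* (y :* y))) refl (ι d) (ι k) y ⟩
  spikeCost (ι d) (1ℚ ℚ.+ ι k) y
    ≡⟨ cong (λ N → spikeCost (ι d) N y) (ι-+ 1 k) ⟨
  spikeCost (ι d) (ι (suc k)) y ∎
  where open ≡-Reasoning

-- Polynomial inequalities behind the failure of the mean

-- Turns an identity that the ring solver proves with a multiple of p - 1 as
-- remainder into one that holds modulo p ≡ 1.
vanish : ∀ {p} q c → p ≡ 1ℚ → q ℚ.+ (p ℚ.- 1ℚ) ℚ.* c ≡ q
vanish q c refl = solve 2 (λ q c → q :+ (con 1ℚ :- con 1ℚ) :* c := q) refl q c

-- At the minimiser `r = 1/N` the cost is `D (1 - r)`, and moving to `x` adds `D N (x - r)²`, which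
-- is at least `D e`. That exceeds `e D (1 - r)` by at least `D e r > 0`, hence the strict
-- inequality.
spikeCost-gap : ∀ {D N r e} x → 0ℚ ℚ.< D → 0ℚ ℚ.< r → 0ℚ ℚ.< e → N ℚ.* r ≡ 1ℚ →
                e ℚ.≤ N ℚ.* ((x ℚ.- r) ℚ.* (x ℚ.- r)) →
                (1ℚ ℚ.+ e) ℚ.* spikeCost D N r ℚ.< spikeCost D N x
spikeCost-gap {D} {N} {r} {e} x 0<D 0<r 0<e Nr≡1 far = 0<q-p⇒p<q (subst (0ℚ ℚ.<_) (sym difference)
  (*-pos 0<D (ℚ.+-mono-≤-< (p≤q⇒0≤q-p far) (*-pos 0<e 0<r))))
  where
  difference : spikeCost D N x ℚ.- (1ℚ ℚ.+ e) ℚ.* spikeCost D N r ≡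
               D ℚ.* ((N ℚ.* ((x ℚ.- r) ℚ.* (x ℚ.- r)) ℚ.- e) ℚ.+ e ℚ.* r)
  difference = trans
    (solve 5 (λ D N x r e →
       D :* ((con 1ℚ :- (x :+ x)) :+ N :* (x :* x)) :- (con 1ℚ :+ e) :* (D :* ((con 1ℚ :- (r :+ r)) :+ N :* (r :* r)))
       := D :* ((N :* ((x :- r) :* (x :- r)) :- e) :+ e :* r)
          :+ (N :* r :- con 1ℚ) :* (D :* (x :+ x :- (con 1ℚ :+ con 1ℚ :+ e) :* r))) refl D N x r e)
    (vanish _ _ Nr≡1)

-- Read `h`, `μ`, `ρ`, `κ` as 1/m, m, 1/K, K, so that `κ μ` is n and `h ρ` is r. Since `ρ ≤ ½`, the
-- number `z = y - ρ` is at least `½`, and the right side equals `h κ z²`, which is at least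
-- `4 e z² ≥ e`.
far-of-hit : ∀ {h μ κ ρ e y} → h ℚ.* μ ≡ 1ℚ → ρ ℚ.* κ ≡ 1ℚ → 0ℚ ℚ.≤ h → 0ℚ ℚ.≤ ρ → 0ℚ ℚ.≤ e →
             ι 2 ℚ.≤ κ → ι 4 ℚ.* (e ℚ.* μ) ℚ.≤ κ → 1ℚ ℚ.≤ y →
             e ℚ.≤ (κ ℚ.* μ) ℚ.* ((h ℚ.* y ℚ.- h ℚ.* ρ) ℚ.* (h ℚ.* y ℚ.- h ℚ.* ρ))
far-of-hit {h} {μ} {κ} {ρ} {e} {y} hμ ρκ 0≤h 0≤ρ 0≤e 2≤κ 4eμ≤κ 1≤y =
  0≤q-p⇒p≤q (subst (0ℚ ℚ.≤_) (sym difference)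
    (ℚ.+-mono-≤ (*-nonNeg 0≤h (*-nonNeg (p≤q⇒0≤q-p 4eμ≤κ) (*-nonNeg 0≤z 0≤z)))
      (*-nonNeg (*-nonNeg (0≤ι 4) 0≤e) (*-nonNeg 0≤t (ℚ.+-mono-≤ 0≤t (0≤ι 1))))))
  where
  z = y ℚ.- ρ
  -- The bound `4 z² ≥ 1` is obtained from `4 z² - 1 = 4 t (t + 1)` and `0 ≤ t`.
  t = z ℚ.- ½
  0≤½ : 0ℚ ℚ.≤ ½
  0≤½ = ℚ.nonNegative⁻¹ ½
  0≤t : 0ℚ ℚ.≤ t
  0≤t = subst (0ℚ ℚ.≤_)
    (trans (solve 3 (λ y ρ κ → (y :- con 1ℚ) :+ con ½ :* (ρ :* (κ :- con (ι 2)))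
                       := ((y :- ρ) :- con ½) :+ (ρ :* κ :- con 1ℚ) :* con ½) refl y ρ κ)
      (vanish _ _ ρκ))
    (ℚ.+-mono-≤ (p≤q⇒0≤q-p 1≤y) (*-nonNeg 0≤½ (*-nonNeg 0≤ρ (p≤q⇒0≤q-p 2≤κ))))
  0≤z : 0ℚ ℚ.≤ z
  0≤z = subst (0ℚ ℚ.≤_) (solve 1 (λ z → (z :- con ½) :+ con ½ := z) refl z) (ℚ.+-mono-≤ 0≤t 0≤½)
  difference : (κ ℚ.* μ) ℚ.* ((h ℚ.* y ℚ.- h ℚ.* ρ) ℚ.* (h ℚ.* y ℚ.- h ℚ.* ρ)) ℚ.- e ≡
               h ℚ.* ((κ ℚ.- ι 4 ℚ.* (e ℚ.* μ)) ℚ.* (z ℚ.* z)) ℚ.+ (ι 4 ℚ.* e) ℚ.* (t ℚ.* (t ℚ.+ 1ℚ))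
  difference = trans
    (solve 6 (λ h μ κ ρ e y → let z = y :- ρ ; t = z :- con ½ in
       (κ :* μ) :* ((h :* y :- h :* ρ) :* (h :* y :- h :* ρ)) :- e
       := (h :* ((κ :- con (ι 4) :* (e :* μ)) :* (z :* z)) :+ (con (ι 4) :* e) :* (t :* (t :+ con 1ℚ)))
          :+ (h :* μ :- con 1ℚ) :* ((κ :* h :+ con (ι 4) :* e) :* (z :* z))) refl h μ κ ρ e y)
    (vanish _ _ hμ)

-- Without a hit the empirical mean is the origin, at distance `r = h ρ` from the true mean, and
-- `n r² = r`. So the claim is `e ≤ h ρ`, which is `κ e μ ≤ 1` after clearing denominators.
far-of-miss : ∀ {h μ κ ρ e} → h ℚ.* μ ≡ 1ℚ → ρ ℚ.* κ ≡ 1ℚ → 0ℚ ℚ.≤ h → 0ℚ ℚ.≤ ρ →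
              κ ℚ.* (e ℚ.* μ) ℚ.≤ 1ℚ →
              e ℚ.≤ (κ ℚ.* μ) ℚ.* ((h ℚ.* 0ℚ ℚ.- h ℚ.* ρ) ℚ.* (h ℚ.* 0ℚ ℚ.- h ℚ.* ρ))
far-of-miss {h} {μ} {κ} {ρ} {e} hμ ρκ 0≤h 0≤ρ κeμ≤1 =
  0≤q-p⇒p≤q (subst (0ℚ ℚ.≤_) (sym difference) (*-nonNeg (*-nonNeg 0≤h 0≤ρ) (p≤q⇒0≤q-p κeμ≤1)))
  where
  difference : (κ ℚ.* μ) ℚ.* ((h ℚ.* 0ℚ ℚ.- h ℚ.* ρ) ℚ.* (h ℚ.* 0ℚ ℚ.- h ℚ.* ρ)) ℚ.- e ≡
               (h ℚ.* ρ) ℚ.* (1ℚ ℚ.- κ ℚ.* (e ℚ.* μ))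
  difference = trans
    (solve 5 (λ h μ κ ρ e →
       (κ :* μ) :* ((h :* con 0ℚ :- h :* ρ) :* (h :* con 0ℚ :- h :* ρ)) :- e
       := ((h :* ρ) :* (con 1ℚ :- κ :* (e :* μ)) :+ (h :* μ :- con 1ℚ) :* ((ρ :* κ) :* (h :* ρ :+ e)))
          :+ (ρ :* κ :- con 1ℚ) :* (h :* ρ :+ e)) refl h μ κ ρ e)
    (trans (vanish _ _ ρκ) (vanish _ _ hμ))

-- From a rational cost gap to the failure of `IsApproxMean`

gap-contradiction : ∀ {e q r E c o z η} → 0ℚ ℚ.≤ E → E ℚ.≤ e → 0ℚ ℚ.≤ q → 0ℚ ℚ.< η →
  (ι 3 ℚ.+ e) ℚ.* η ≡ r ℚ.- (1ℚ ℚ.+ e) ℚ.* q → c ≡ r → z ≡ q →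
  o ℚ.≤ z ℚ.+ η → ¬ c ℚ.≤ (1ℚ ℚ.+ E) ℚ.* o ℚ.+ η
gap-contradiction {e} {q} {r} {E} {c} {o} {z} {η} 0≤E E≤e 0≤q 0<η Bη refl refl o≤ c≤ = ℚ.<-irrefl refl (begin-strict
    r                                               ≤⟨ c≤ ⟩
    (1ℚ ℚ.+ E) ℚ.* o ℚ.+ η                          ≤⟨ ℚ.+-monoˡ-≤ η (ℚ.*-monoˡ-≤-nonNeg (1ℚ ℚ.+ E) {{ℚ.nonNegative (ℚ.+-mono-≤ (0≤ι 1) 0≤E)}} o≤) ⟩
    (1ℚ ℚ.+ E) ℚ.* (q ℚ.+ η) ℚ.+ η                  ≤⟨ ℚ.+-monoˡ-≤ η (ℚ.*-monoʳ-≤-nonNeg (q ℚ.+ η) {{ℚ.nonNegative (ℚ.+-mono-≤ 0≤q (ℚ.<⇒≤ 0<η))}} (ℚ.+-monoʳ-≤ 1ℚ E≤e)) ⟩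
    -- The two approximation errors add up to `(2 + e) η`; the factor `3 + e` in the choice of `η`
    -- leaves one `η` to spare.
    (1ℚ ℚ.+ e) ℚ.* (q ℚ.+ η) ℚ.+ η                  <⟨ 0<q-p⇒p<q (subst (0ℚ ℚ.<_) (sym slack) 0<η) ⟩
    (1ℚ ℚ.+ e) ℚ.* q ℚ.+ (ι 3 ℚ.+ e) ℚ.* η          ≡⟨ cong ((1ℚ ℚ.+ e) ℚ.* q ℚ.+_) Bη ⟩
    (1ℚ ℚ.+ e) ℚ.* q ℚ.+ (r ℚ.- (1ℚ ℚ.+ e) ℚ.* q)   ≡⟨ solve 2 (λ a r → a :+ (r :- a) := r) refl ((1ℚ ℚ.+ e) ℚ.* q) r ⟩
    r                                               ∎)
  where
  open ℚ.≤-Reasoning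
  slack : (1ℚ ℚ.+ e) ℚ.* q ℚ.+ (ι 3 ℚ.+ e) ℚ.* η ℚ.- ((1ℚ ℚ.+ e) ℚ.* (q ℚ.+ η) ℚ.+ η) ≡ η
  slack = solve 3 (λ e q η → (con 1ℚ :+ e) :* q :+ (con (ι 3) :+ e) :* η :- ((con 1ℚ :+ e) :* (q :+ η) :+ η) := η) refl e q η

-- The optimum is at most the cost of any competitor `z`, so losing to `z` by more than the factor
-- `1 + e` suffices. All real inequalities are compared at one index past their four thresholds.
¬IsApproxMean-of-gap : ∀ {d n ε e q r} (A : Vector (Point d) n) (x z : Point d) →
  0ℝ < ε → 0ℚ ℚ.≤ e → 0ℚ ℚ.≤ q → (∃[ N ] ∀ i → N ℕ.≤ i → seq ε i ℚ.≤ e) →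
  (∀ i → seq (cost A x) i ≡ r) → (∀ i → seq (cost A z) i ≡ q) →
  (1ℚ ℚ.+ e) ℚ.* q ℚ.< r → ¬ IsApproxMean ε A x
¬IsApproxMean-of-gap {ε = ε} {e} {q} {r} A x z (mk< α 0<α (N₁ , α≤ε)) 0≤e 0≤q (N₂ , ε≤e) x≡r z≡q gap
  (Opt , (_ , Opt≤) , mk≤ near) =
  let η , 0<η , Bη = divide {ι 3 ℚ.+ e} (ℚ.+-mono-<-≤ (0<ι 3) 0≤e) (p<q⇒0<q-p gap)
      N₃ , Opt≤q = _≤_.bound (Opt≤ z) η 0<η
      N₄ , r≤Opt = near η 0<η
      i = (N₁ ℕ.⊔ N₂) ℕ.⊔ (N₃ ℕ.⊔ N₄)
      i≥₁₂ = ℕ.m≤m⊔n (N₁ ℕ.⊔ N₂) (N₃ ℕ.⊔ N₄)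
      i≥₃₄ = ℕ.m≤n⊔m (N₁ ℕ.⊔ N₂) (N₃ ℕ.⊔ N₄)
      0≤ε = ℚ.≤-trans (ℚ.<⇒≤ 0<α) (subst (ℚ._≤ seq ε i) (ℚ.+-identityˡ α) (α≤ε i (ℕ.m⊔n≤o⇒m≤o N₁ N₂ i≥₁₂)))
  in gap-contradiction {E = seq ε i} {o = seq Opt i} 0≤ε (ε≤e i (ℕ.m⊔n≤o⇒n≤o N₁ N₂ i≥₁₂)) 0≤q 0<η Bη
       (x≡r i) (z≡q i) (Opt≤q i (ℕ.m⊔n≤o⇒m≤o N₃ N₄ i≥₃₄)) (r≤Opt i (ℕ.m⊔n≤o⇒n≤o N₃ N₄ i≥₃₄))

-- Hits of the spike and the empirical mean

ones : ∀ {k m} → Sample (suc k) m → ℚ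
ones []          = 0ℚ
ones (zero  ∷ s) = 1ℚ ℚ.+ ones s
-- The summand `0ℚ` is kept so that `ones` matches the sum of the sampled coordinates clause by
-- clause.
ones (suc _ ∷ s) = 0ℚ ℚ.+ ones s

seq-∑-spike : ∀ {d k m} (s : Sample (suc k) m) j i →
              seq (∑ (λ l → spike d k (Vec.lookup s l) j)) i ≡ ones s
seq-∑-spike []          j i = refl
seq-∑-spike (zero  ∷ s) j i = cong (1ℚ ℚ.+_) (seq-∑-spike s j i)
seq-∑-spike (suc _ ∷ s) j i = cong (0ℚ ℚ.+_) (seq-∑-spike s j i)

seq-empiricalMean-spike : ∀ {d k m} .{{_ : NonZero m}} (s : Sample (suc k) m) j i →
  seq (empiricalMean (spike d k) s j) i ≡ (+ 1 ℚ./ m) ℚ.* ones s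
seq-empiricalMean-spike {d} {m = m} s j i = cong ((+ 1 ℚ./ m) ℚ.*_) (seq-∑-spike {d} s j i)

Hits : ∀ {k m} → Pred (Sample (suc k) m) 0ℓ
Hits = Any (_≡ zero)

hits? : ∀ {k m} → Decidable (Hits {k} {m})
hits? = any? (Fin._≟ zero)

0≤ones : ∀ {k m} (s : Sample (suc k) m) → 0ℚ ℚ.≤ ones s
0≤ones []          = ℚ.≤-refl
0≤ones (zero  ∷ s) = ℚ.+-mono-≤ (0≤ι 1) (0≤ones s)
0≤ones (suc _ ∷ s) = ℚ.+-mono-≤ (0≤ι 0) (0≤ones s)

hits⇒1≤ones : ∀ {k m} {s : Sample (suc k) m} → Hits s → 1ℚ ℚ.≤ ones s
hits⇒1≤ones {s = _ ∷ s} (here refl) = ℚ.+-monoʳ-≤ 1ℚ (0≤ones s)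
hits⇒1≤ones {s = zero  ∷ s} (there p) = ℚ.+-mono-≤ (0≤ι 1) (hits⇒1≤ones p)
hits⇒1≤ones {s = suc _ ∷ s} (there p) = ℚ.+-mono-≤ (0≤ι 0) (hits⇒1≤ones p)

misses⇒ones≡0 : ∀ {k m} {s : Sample (suc k) m} → ¬ Hits s → ones s ≡ 0ℚ
misses⇒ones≡0 {s = []}        _    = refl
misses⇒ones≡0 {s = zero  ∷ s} miss = contradiction (here refl) miss
misses⇒ones≡0 {s = suc _ ∷ s} miss = cong (0ℚ ℚ.+_) (misses⇒ones≡0 (miss ∘ there))

-- Failure of the empirical mean on the spike instance

¬IsApproxMean-of-far : ∀ {d k ε e r y} .{{_ : NonZero d}} (x : Point d) → (∀ i j → seq (x j) i ≡ y) →
  0ℝ < ε → 0ℚ ℚ.< e → (∃[ N ] ∀ i → N ℕ.≤ i → seq ε i ℚ.≤ e) →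
  ι (suc k) ℚ.* r ≡ 1ℚ → 0ℚ ℚ.< r → e ℚ.≤ ι (suc k) ℚ.* ((y ℚ.- r) ℚ.* (y ℚ.- r)) →
  ¬ IsApproxMean ε (spike d k) x
¬IsApproxMean-of-far {d} {k} {r = r} {y} x x≡y 0<ε 0<e ε≤e Nr≡1 0<r far =
  ¬IsApproxMean-of-gap {q = spikeCost (ι d) (ι (suc k)) r} {r = spikeCost (ι d) (ι (suc k)) y}
    -- The competitor is the true mean, all of whose coordinates are 1/n.
    (spike d k) x (λ _ → fromℚ r) 0<ε (ℚ.<⇒≤ 0<e) 0≤optimum ε≤e
    (λ i → seq-cost-spike d k x i (x≡y i))
    (λ i → seq-cost-spike d k (λ _ → fromℚ r) i (λ _ → refl))
    (spikeCost-gap {N = ι (suc k)} y (0<ι d) 0<r 0<e Nr≡1 far)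
  where
  -- In this form the optimum is visibly nonnegative.
  optimum≡ : spikeCost (ι d) (ι (suc k)) r ≡ ι d ℚ.* (r ℚ.* ι k)
  optimum≡ = begin
    spikeCost (ι d) (ι (suc k)) r                   ≡⟨ cong (λ N → spikeCost (ι d) N r) (ι-+ 1 k) ⟩
    spikeCost (ι d) (1ℚ ℚ.+ ι k) r
      ≡⟨ solve 3 (λ D r k → D :* ((con 1ℚ :- (r :+ r)) :+ (con 1ℚ :+ k) :* (r :* r))
           := D :* (r :* k) :+ ((con 1ℚ :+ k) :* r :- con 1ℚ) :* (D :* (r :- con 1ℚ))) refl (ι d) r (ι k) ⟩
    ι d ℚ.* (r ℚ.* ι k) ℚ.+ ((1ℚ ℚ.+ ι k) ℚ.* r ℚ.- 1ℚ) ℚ.* (ι d ℚ.* (r ℚ.- 1ℚ))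
      ≡⟨ vanish _ _ (trans (cong (ℚ._* r) (sym (ι-+ 1 k))) Nr≡1) ⟩
    ι d ℚ.* (r ℚ.* ι k)                             ∎
    where open ≡-Reasoning
  0≤optimum : 0ℚ ℚ.≤ spikeCost (ι d) (ι (suc k)) r
  0≤optimum = subst (0ℚ ℚ.≤_) (sym optimum≡) (*-nonNeg (0≤ι d) (*-nonNeg (ℚ.<⇒≤ 0<r) (0≤ι k)))

module _ {k m K : ℕ} .{{m≢0 : NonZero m}} .{{K≢0 : NonZero K}} (N≡Km : ι (suc k) ≡ ι K ℚ.* ι m) where

  private
    h = + 1 ℚ./ m
    ρ = + 1 ℚ./ K

    hμ : h ℚ.* ι m ≡ 1ℚ
    hμ = /-*-ι 1 m

    ρκ : ρ ℚ.* ι K ≡ 1ℚ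
    ρκ = /-*-ι 1 K

    0<h : 0ℚ ℚ.< h
    0<h = ℚ.positive⁻¹ h {{ℚ.normalize-pos 1 m}}

    0<ρ : 0ℚ ℚ.< ρ
    0<ρ = ℚ.positive⁻¹ ρ {{ℚ.normalize-pos 1 K}}

    Nr≡1 : ι (suc k) ℚ.* (h ℚ.* ρ) ≡ 1ℚ
    Nr≡1 = begin
      ι (suc k) ℚ.* (h ℚ.* ρ)          ≡⟨ cong (ℚ._* (h ℚ.* ρ)) N≡Km ⟩
      ι K ℚ.* ι m ℚ.* (h ℚ.* ρ)
        ≡⟨ solve 4 (λ κ μ h ρ → κ :* μ :* (h :* ρ) := (h :* μ) :* (ρ :* κ)) refl (ι K) (ι m) h ρ ⟩
      (h ℚ.* ι m) ℚ.* (ρ ℚ.* ι K)      ≡⟨ cong₂ ℚ._*_ hμ ρκ ⟩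
      1ℚ                               ∎
      where open ≡-Reasoning

    Far : ℚ → ℚ → ℚ → Set
    Far e N y = e ℚ.≤ N ℚ.* ((h ℚ.* y ℚ.- h ℚ.* ρ) ℚ.* (h ℚ.* y ℚ.- h ℚ.* ρ))

  module _ {d : ℕ} .{{d≢0 : NonZero d}} {ε e} (0<ε : 0ℝ < ε) (0<e : 0ℚ ℚ.< e)
           (ε≤e : ∃[ N ] ∀ i → N ℕ.≤ i → seq ε i ℚ.≤ e) (s : Sample (suc k) m) where

    private
      fails : Far e (ι K ℚ.* ι m) (ones s) →
              ¬ IsApproxMean {d} {suc k} ε (spike d k) (empiricalMean {d} {suc k} {m} {{m≢0}} (spike d k) s)
      fails far = ¬IsApproxMean-of-far {d} {k} {ε} {e} {h ℚ.* ρ} {h ℚ.* ones s} {{d≢0}}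
        (empiricalMean {d} {suc k} {m} {{m≢0}} (spike d k) s)
        (λ i j → seq-empiricalMean-spike {d} {k} {m} {{m≢0}} s j i)
        0<ε 0<e ε≤e Nr≡1 (*-pos 0<h 0<ρ)
        (subst (λ N → Far e N (ones s)) (sym N≡Km) far)

      far-if-hit : ι 2 ℚ.≤ ι K → ι 4 ℚ.* (e ℚ.* ι m) ℚ.≤ ι K → Hits s → Far e (ι K ℚ.* ι m) (ones s)
      far-if-hit 2≤K 4em≤K hit =
        far-of-hit hμ ρκ (ℚ.<⇒≤ 0<h) (ℚ.<⇒≤ 0<ρ) (ℚ.<⇒≤ 0<e) 2≤K 4em≤K (hits⇒1≤ones hit)

    spike-fails-on-hit : ι 2 ℚ.≤ ι K → ι 4 ℚ.* (e ℚ.* ι m) ℚ.≤ ι K → Hits s →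
      ¬ IsApproxMean {d} {suc k} ε (spike d k) (empiricalMean {d} {suc k} {m} {{m≢0}} (spike d k) s)
    spike-fails-on-hit 2≤K 4em≤K hit = fails (far-if-hit 2≤K 4em≤K hit)

    -- The lower bound on `K` makes samples with a hit fail, the upper bound those without. For
    -- `K = 2` both amount to `2 e m ≤ 1`.
    spike-fails : ι 2 ℚ.≤ ι K → ι 4 ℚ.* (e ℚ.* ι m) ℚ.≤ ι K → ι K ℚ.* (e ℚ.* ι m) ℚ.≤ 1ℚ →
      ¬ IsApproxMean {d} {suc k} ε (spike d k) (empiricalMean {d} {suc k} {m} {{m≢0}} (spike d k) s)
    spike-fails 2≤K 4em≤K Kem≤1 = fails (far (hits? s))
      where
      far : Dec (Hits s) → Far e (ι K ℚ.* ι m) (ones s)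
      far (yes hit) = far-if-hit 2≤K 4em≤K hit
      far (no miss) = subst (Far e (ι K ℚ.* ι m)) (sym (misses⇒ones≡0 miss))
        (far-of-miss hμ ρκ (ℚ.<⇒≤ 0<h) (ℚ.<⇒≤ 0<ρ) Kem≤1)

-- Counting samples and the probability of a hit

length-cartesianProductWith : ∀ {A B C : Set} (f : A → B → C) xs ys →
  List.length (List.cartesianProductWith f xs ys) ≡ List.length xs ℕ.* List.length ys
length-cartesianProductWith f []       ys = refl
length-cartesianProductWith f (x ∷ xs) ys = trans (List.length-++ (List.map (f x) ys))
  (cong₂ ℕ._+_ (List.length-map (f x) ys) (length-cartesianProductWith f xs ys))

length-allSamples : ∀ n m → List.length (allSamples n m) ≡ n ℕ.^ m
length-allSamples n ℕ.zero  = refl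
length-allSamples n (suc m) = trans (length-cartesianProductWith _∷_ (List.allFin n) (allSamples n m))
  (cong₂ ℕ._*_ (List.length-tabulate {n = n} (λ i → i)) (length-allSamples n m))

Pr-all : ∀ n m .{{_ : NonZero n}} → Pr {n} {m} (λ _ → yes tt) ≡ 1ℚ
Pr-all n m = begin
  P                        ≡⟨ ℚ.*-identityʳ P ⟨
  P ℚ.* 1ℚ                 ≡⟨ cong (P ℚ.*_) (ℚ.*-inverseʳ (ι (n ℕ.^ m))) ⟨
  P ℚ.* (ι (n ℕ.^ m) ℚ.* ℚ.1/ ι (n ℕ.^ m))   ≡⟨ ℚ.*-assoc P (ι (n ℕ.^ m)) (ℚ.1/ ι (n ℕ.^ m)) ⟨
  P ℚ.* ι (n ℕ.^ m) ℚ.* ℚ.1/ ι (n ℕ.^ m)     ≡⟨ cong (ℚ._* ℚ.1/ ι (n ℕ.^ m)) (/-*-ι all (n ℕ.^ m)) ⟩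
  ι all ℚ.* ℚ.1/ ι (n ℕ.^ m)
    ≡⟨ cong (λ l → ι l ℚ.* ℚ.1/ ι (n ℕ.^ m))
         (trans (cong List.length (List.filter-all (λ _ → yes tt) (All.universal (λ _ → tt) (allSamples n m))))
           (length-allSamples n m)) ⟩
  ι (n ℕ.^ m) ℚ.* ℚ.1/ ι (n ℕ.^ m)           ≡⟨ ℚ.*-inverseʳ (ι (n ℕ.^ m)) ⟩
  1ℚ                       ∎
  where
  open ≡-Reasoning
  instance
    power-nonZero : NonZero (n ℕ.^ m)
    power-nonZero = ℕ.m^n≢0 n m
    ι-nonZero : ℚ.NonZero (ι (n ℕ.^ m))
    ι-nonZero = ℚ.pos⇒nonZero (ι (n ℕ.^ m)) {{ℚ.positive (0<ι (n ℕ.^ m))}}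
  P = Pr {n} {m} (λ _ → yes tt)
  all = List.length (List.filter (λ _ → yes tt) (allSamples n m))

#hits : ∀ {k m} → List (Sample (suc k) m) → ℕ
#hits S = List.length (List.filter hits? S)

#hits-map-zero∷ : ∀ {k m} (S : List (Sample (suc k) m)) → #hits (List.map (zero ∷_) S) ≡ List.length S
#hits-map-zero∷ []      = refl
#hits-map-zero∷ (s ∷ S) = cong suc (#hits-map-zero∷ S)

#hits-map-suc∷ : ∀ {k m} i (S : List (Sample (suc k) m)) → #hits (List.map (suc i ∷_) S) ≡ #hits S
#hits-map-suc∷ i []      = refl
#hits-map-suc∷ i (s ∷ S) with does (hits? s)
... | false = #hits-map-suc∷ i S
... | true  = cong suc (#hits-map-suc∷ i S)

#hits-++ : ∀ {k m} (S T : List (Sample (suc k) m)) → #hits (S List.++ T) ≡ #hits S ℕ.+ #hits T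
#hits-++ S T = trans (cong List.length (List.filter-++ hits? S T)) (List.length-++ (List.filter hits? S))

-- The function `f` is arbitrary because the induction on `l` replaces it by `f ∘ suc`; the identity
-- is the case of interest.
#hits-suc∷ : ∀ {k m l} (f : Fin l → Fin k) (S : List (Sample (suc k) m)) →
  #hits (List.cartesianProductWith _∷_ (List.tabulate (suc ∘ f)) S) ≡ l ℕ.* #hits S
#hits-suc∷ {l = ℕ.zero} f S = refl
#hits-suc∷ {l = suc l}  f S = trans (#hits-++ (List.map (suc (f zero) ∷_) S) _)
  (cong₂ ℕ._+_ (#hits-map-suc∷ (f zero) S) (#hits-suc∷ (f ∘ suc) S))

-- Split on the first draw: after the spike every continuation counts, and after each of the other
-- `k` points only the continuations that hit.
#hits-allSamples-suc : ∀ k m →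
  #hits (allSamples (suc k) (suc m)) ≡ suc k ℕ.^ m ℕ.+ k ℕ.* #hits (allSamples (suc k) m)
#hits-allSamples-suc k m = trans (#hits-++ (List.map (zero ∷_) S) _)
  (cong₂ ℕ._+_ (trans (#hits-map-zero∷ S) (length-allSamples (suc k) m)) (#hits-suc∷ (λ i → i) S))
  where S = allSamples (suc k) m

-- A Bernoulli inequality: 1 - (1 - 1/n)^m ≥ m/(n + m) for n = suc k.
#hits-lower-bound : ∀ k m → m ℕ.* suc k ℕ.^ m ℕ.≤ #hits (allSamples (suc k) m) ℕ.* (suc k ℕ.+ m)
#hits-lower-bound k ℕ.zero  = ℕ.z≤n
#hits-lower-bound k (suc m) = begin
  suc m ℕ.* (suc k ℕ.* P)
    ≡⟨ ℕ-Solver.solve 3 (λ k m P → (con₁ 1 ⊕ m) ⊗ ((con₁ 1 ⊕ k) ⊗ P) ℕ-Solver.:= P ⊗ (con₁ 1 ⊕ k ⊕ m) ⊕ k ⊗ (m ⊗ P)) refl k m P ⟩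
  P ℕ.* (1 ℕ.+ k ℕ.+ m) ℕ.+ k ℕ.* (m ℕ.* P)
    ≤⟨ ℕ.+-monoʳ-≤ (P ℕ.* (1 ℕ.+ k ℕ.+ m)) (ℕ.*-monoʳ-≤ k (#hits-lower-bound k m)) ⟩
  P ℕ.* (1 ℕ.+ k ℕ.+ m) ℕ.+ k ℕ.* (H ℕ.* (suc k ℕ.+ m))
    -- The added `P + k H` is what raises the factor `suc k + m` to `suc k + suc m`.
    ≤⟨ ℕ.m≤m+n _ (P ℕ.+ k ℕ.* H) ⟩
  P ℕ.* (1 ℕ.+ k ℕ.+ m) ℕ.+ k ℕ.* (H ℕ.* (suc k ℕ.+ m)) ℕ.+ (P ℕ.+ k ℕ.* H)
    ≡⟨ ℕ-Solver.solve 4 (λ k m P H → P ⊗ (con₁ 1 ⊕ k ⊕ m) ⊕ k ⊗ (H ⊗ (con₁ 1 ⊕ k ⊕ m)) ⊕ (P ⊕ k ⊗ H)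
         ℕ-Solver.:= (P ⊕ k ⊗ H) ⊗ (con₁ 1 ⊕ k ⊕ (con₁ 1 ⊕ m))) refl k m P H ⟩
  (P ℕ.+ k ℕ.* H) ℕ.* (suc k ℕ.+ suc m)
    ≡⟨ cong (ℕ._* (suc k ℕ.+ suc m)) (#hits-allSamples-suc k m) ⟨
  #hits (allSamples (suc k) (suc m)) ℕ.* (suc k ℕ.+ suc m) ∎
  where
  open ℕ.≤-Reasoning
  open ℕ-Solver using () renaming (_:+_ to infixl 6 _⊕_; _:*_ to infixl 7 _⊗_; con to con₁)
  P = suc k ℕ.^ m
  H = #hits (allSamples (suc k) m)

-- For `n = K m` the lower bound `m / (n + m)` on the probability becomes `1 / (K + 1)`, and `D` is
-- at most that.
Pr-hits-lower-bound : ∀ {D} k m K .{{_ : NonZero m}} → suc k ≡ K ℕ.* m →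
  0ℚ ℚ.≤ D → D ℚ.* (ι K ℚ.+ 1ℚ) ℚ.≤ 1ℚ → D ℚ.≤ Pr {suc k} {m} {F = Hits {k} {m}} (hits? {k} {m})
Pr-hits-lower-bound {D} k m K n≡Km 0≤D D[K+1]≤1 = ℚ.*-cancelʳ-≤-pos (ι T) {{ℚ.positive (0<ι T)}} (begin
  D ℚ.* ι T                                ≤⟨ ℚ.*-monoˡ-≤-nonNeg D {{ℚ.nonNegative 0≤D}} (ι-mono-≤ T≤) ⟩
  D ℚ.* ι ((K ℕ.+ 1) ℕ.* H)                ≡⟨ cong (D ℚ.*_) (trans (ι-* (K ℕ.+ 1) H) (cong (ℚ._* ι H) (ι-+ K 1))) ⟩
  D ℚ.* ((ι K ℚ.+ 1ℚ) ℚ.* ι H)             ≡⟨ ℚ.*-assoc D (ι K ℚ.+ 1ℚ) (ι H) ⟨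
  D ℚ.* (ι K ℚ.+ 1ℚ) ℚ.* ι H               ≤⟨ ℚ.*-monoʳ-≤-nonNeg (ι H) {{ℚ.nonNegative (0≤ι H)}} D[K+1]≤1 ⟩
  1ℚ ℚ.* ι H                               ≡⟨ ℚ.*-identityˡ (ι H) ⟩
  ι H                                      ≡⟨ /-*-ι H T ⟨
  Pr {suc k} {m} hits? ℚ.* ι T             ∎)
  where
  open ℚ.≤-Reasoning
  T = suc k ℕ.^ m
  H = #hits (allSamples (suc k) m)
  instance
    T-nonZero : NonZero T
    T-nonZero = ℕ.m^n≢0 (suc k) m
  T≤ : T ℕ.≤ (K ℕ.+ 1) ℕ.* H
  T≤ = ℕ.*-cancelˡ-≤ m (ℕ.≤-trans (#hits-lower-bound k m)
    (ℕ.≤-reflexive (trans (cong (λ n → H ℕ.* (n ℕ.+ m)) n≡Km) (ℕ-Solver.solve 3 (λ K m H → H ⊗ (K ⊗ m ⊕ m) ℕ-Solver.:= m ⊗ ((K ⊕ con₁ 1) ⊗ H)) refl K m H))))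
    where open ℕ-Solver using () renaming (_:+_ to infixl 6 _⊕_; _:*_ to infixl 7 _⊗_; con to con₁)

-- Rational bounds replacing the reals ε and δ

1/max-inverseˡ : ∀ {η q} (0<η : 0ℚ ℚ.< η) → η ℚ.≤ q → 1/max 0<η q ℚ.* q ≡ 1ℚ
1/max-inverseˡ {η} {q} 0<η η≤q = trans
  (cong (1/max 0<η q ℚ.*_) (sym (ℚ.p≤q⇒p⊔q≡q η≤q)))
  (ℚ.*-inverseˡ (η ℚ.⊔ q) {{ℚ.pos⇒nonZero (η ℚ.⊔ q) {{ℚ.positive (ℚ.<-≤-trans 0<η (ℚ.p≤p⊔q η q))}}}})

-- The constant `c` of the theorem; it reflects `K + 1 ≤ 4 e m + 2 ≤ 8 e m` when `2 e m ≥ 1`.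
⅛ : ℚ
⅛ = + 1 ℚ./ 8

-- Replacing a = εᵢ and b = δᵢ by the rational upper bounds a + θ and b + 2θ
-- costs at most 5μθ, which the gap g of the hypothesis absorbs.
perturbed-bound : ∀ {a b u v μ g α β θ} →
  u ℚ.* a ≡ 1ℚ → v ℚ.* b ≡ 1ℚ → 0ℚ ℚ.< α → 0ℚ ℚ.< β → 0ℚ ℚ.≤ μ → 0ℚ ℚ.< g → 0ℚ ℚ.< θ →
  α ℚ.≤ a → β ℚ.≤ b → a ℚ.≤ 1ℚ → b ℚ.≤ 1ℚ → μ ℚ.+ g ℚ.≤ ⅛ ℚ.* u ℚ.* v →
  (ι 5 ℚ.* μ ℚ.+ g ℚ.* (α ℚ.* β)) ℚ.* θ ≡ g ℚ.* (α ℚ.* β) →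
  ι 8 ℚ.* ((a ℚ.+ θ) ℚ.* μ) ℚ.* (b ℚ.+ ι 2 ℚ.* θ) ℚ.≤ 1ℚ
perturbed-bound {a} {b} {u} {v} {μ} {g} {α} {β} {θ} ua vb 0<α 0<β 0≤μ 0<g 0<θ α≤a β≤b a≤1 b≤1 hyp Bθ≡w =
  0≤q-p⇒p≤q (subst (0ℚ ℚ.≤_) (sym difference) (*-nonNeg (0≤ι 8)
    (ℚ.+-mono-≤ (p≤q⇒0≤q-p [μ+g]ab≤⅛)
    (ℚ.+-mono-≤ (*-nonNeg 0≤g (ℚ.+-mono-≤ (*-nonNeg (p≤q⇒0≤q-p α≤a) (ℚ.≤-trans (ℚ.<⇒≤ 0<β) β≤b))
                                          (*-nonNeg (ℚ.<⇒≤ 0<α) (p≤q⇒0≤q-p β≤b))))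
    (ℚ.+-mono-≤ (*-nonNeg (ℚ.<⇒≤ 0<w) 0≤θ)
      (*-nonNeg (*-nonNeg 0≤μ 0≤θ)
        (ℚ.+-mono-≤ (ℚ.+-mono-≤ (*-nonNeg (0≤ι 2) (p≤q⇒0≤q-p a≤1)) (p≤q⇒0≤q-p b≤1))
                    (*-nonNeg (0≤ι 2) 0≤1-θ))))))))
  where
  0≤g = ℚ.<⇒≤ 0<g
  0≤θ = ℚ.<⇒≤ 0<θ
  w = g ℚ.* (α ℚ.* β)
  B = ι 5 ℚ.* μ ℚ.+ w
  0<w : 0ℚ ℚ.< w
  0<w = *-pos 0<g (*-pos 0<α 0<β)
  0<B : 0ℚ ℚ.< B
  0<B = ℚ.+-mono-≤-< (*-nonNeg (0≤ι 5) 0≤μ) 0<w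
  cancel : ∀ q c {s t} → s ≡ t → q ℚ.+ c ℚ.* (t ℚ.- s) ≡ q
  cancel q c {s} refl = solve 3 (λ q c s → q :+ c :* (s :- s) := q) refl q c s
  θ≤1 : θ ℚ.≤ 1ℚ
  θ≤1 = ℚ.*-cancelˡ-≤-pos B {{ℚ.positive 0<B}} (begin
    B ℚ.* θ        ≡⟨ Bθ≡w ⟩
    w              ≡⟨ ℚ.+-identityˡ w ⟨
    0ℚ ℚ.+ w       ≤⟨ ℚ.+-monoˡ-≤ w (*-nonNeg (0≤ι 5) 0≤μ) ⟩
    B              ≡⟨ ℚ.*-identityʳ B ⟨
    B ℚ.* 1ℚ       ∎)
    where open ℚ.≤-Reasoning
  0≤1-θ = p≤q⇒0≤q-p θ≤1
  [μ+g]ab≤⅛ : (μ ℚ.+ g) ℚ.* (a ℚ.* b) ℚ.≤ ⅛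
  [μ+g]ab≤⅛ = begin
    (μ ℚ.+ g) ℚ.* (a ℚ.* b)            ≤⟨ ℚ.*-monoʳ-≤-nonNeg (a ℚ.* b) {{ℚ.nonNegative
                                           (*-nonNeg (ℚ.≤-trans (ℚ.<⇒≤ 0<α) α≤a) (ℚ.≤-trans (ℚ.<⇒≤ 0<β) β≤b))}} hyp ⟩
    ⅛ ℚ.* u ℚ.* v ℚ.* (a ℚ.* b)        ≡⟨ solve 5 (λ c u v a b → c :* u :* v :* (a :* b) := c :* ((u :* a) :* (v :* b))) refl ⅛ u v a b ⟩
    ⅛ ℚ.* ((u ℚ.* a) ℚ.* (v ℚ.* b))    ≡⟨ cong₂ (λ s t → ⅛ ℚ.* (s ℚ.* t)) ua vb ⟩
    ⅛                                  ∎
    where open ℚ.≤-Reasoning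
  -- Expanding `(a + θ)(b + 2θ)` produces the error `θ (2a + b + 2θ) ≤ 5θ`. The gap contributes
  -- `g a b ≥ w`, and `w = 5μθ + wθ` by the choice of `θ`.
  difference : 1ℚ ℚ.- ι 8 ℚ.* ((a ℚ.+ θ) ℚ.* μ) ℚ.* (b ℚ.+ ι 2 ℚ.* θ) ≡
    ι 8 ℚ.* ((⅛ ℚ.- (μ ℚ.+ g) ℚ.* (a ℚ.* b))
      ℚ.+ (g ℚ.* ((a ℚ.- α) ℚ.* b ℚ.+ α ℚ.* (b ℚ.- β))
      ℚ.+ (w ℚ.* θ
      ℚ.+ (μ ℚ.* θ) ℚ.* (ι 2 ℚ.* (1ℚ ℚ.- a) ℚ.+ (1ℚ ℚ.- b) ℚ.+ ι 2 ℚ.* (1ℚ ℚ.- θ)))))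
  difference = trans
    (solve 7 (λ a b μ g α β θ → let w = g :* (α :* β) in
      con 1ℚ :- con (ι 8) :* ((a :+ θ) :* μ) :* (b :+ con (ι 2) :* θ)
      := con (ι 8) :* ((con ⅛ :- (μ :+ g) :* (a :* b))
           :+ (g :* ((a :- α) :* b :+ α :* (b :- β))
           :+ (w :* θ
           :+ (μ :* θ) :* (con (ι 2) :* (con 1ℚ :- a) :+ (con 1ℚ :- b) :+ con (ι 2) :* (con 1ℚ :- θ)))))
         :+ con (ι 8) :* (w :- (con (ι 5) :* μ :+ w) :* θ)) refl a b μ g α β θ)
    (cancel _ (ι 8) Bθ≡w)

∣p-q∣<θ⇒p≤q+θ : ∀ p q {θ} → ∣ p ℚ.- q ∣ ℚ.< θ → p ℚ.≤ q ℚ.+ θ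
∣p-q∣<θ⇒p≤q+θ p q {θ} close = begin
  p                      ≡⟨ solve 2 (λ p q → p := q :+ (p :- q)) refl p q ⟩
  q ℚ.+ (p ℚ.- q)        ≤⟨ ℚ.+-monoʳ-≤ q (ℚ.≤-trans (p≤∣p∣ (p ℚ.- q)) (ℚ.<⇒≤ close)) ⟩
  q ℚ.+ θ                ∎
  where open ℚ.≤-Reasoning

-- The order on ℝ is not decidable, whereas the split on `2 e m ≤ 1` and the choice of `K` as a
-- ceiling compare rationals. The margin `θ` later serves as the gap witnessing that δ is strictly
-- below the probability.
record RationalBounds (ε δ : ℝ) (m : ℕ) : Set where
  field
    e D θ : ℚ
    0<e   : 0ℚ ℚ.< e
    0<D   : 0ℚ ℚ.< D
    0<θ   : 0ℚ ℚ.< θ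
    ε≤e   : ∃[ N ] ∀ i → N ℕ.≤ i → seq ε i ℚ.≤ e
    δ+θ≤D : ∃[ N ] ∀ i → N ℕ.≤ i → seq δ i ℚ.+ θ ℚ.≤ D
    8emD≤1 : ι 8 ℚ.* (e ℚ.* ι m) ℚ.* D ℚ.≤ 1ℚ

rationalBounds : ∀ {ε δ} (0<ε : 0ℝ < ε) (0<δ : 0ℝ < δ) → ε < 1ℝ → δ < 1ℝ → ∀ m →
  fromℕ m < fromℚ ⅛ * inv ε 0<ε * inv δ 0<δ → RationalBounds ε δ m
rationalBounds {ε} {δ} (mk< α 0<α (N₁ , α≤ε)) (mk< β 0<β (N₂ , β≤δ)) (mk< _ 0<γ (N₃ , ε≤1)) (mk< _ 0<ζ (N₄ , δ≤1))
  m (mk< g 0<g (N₅ , hyp)) =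
  let 0<w = *-pos 0<g (*-pos 0<α 0<β)
      -- The index `n` depends on `θ` through the Cauchy moduli, so `θ` is built from the lower
      -- bounds `α`, `β` and not from the values `a`, `b` at `n`.
      θ , 0<θ , Bθ≡w = divide {ι 5 ℚ.* ι m ℚ.+ g ℚ.* (α ℚ.* β)}
                         (ℚ.+-mono-≤-< (*-nonNeg (0≤ι 5) (0≤ι m)) 0<w) 0<w
      N₆ , ε-close = cauchy ε θ 0<θ
      N₇ , δ-close = cauchy δ θ 0<θ
      M₅ = N₅ ℕ.⊔ (N₆ ℕ.⊔ N₇)
      M₃ = N₃ ℕ.⊔ (N₄ ℕ.⊔ M₅)
      n  = N₁ ℕ.⊔ (N₂ ℕ.⊔ M₃)
      n≥M₃ = ℕ.m⊔n≤o⇒n≤o N₂ M₃ (ℕ.m⊔n≤o⇒n≤o N₁ (N₂ ℕ.⊔ M₃) ℕ.≤-refl)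
      n≥M₅ = ℕ.m⊔n≤o⇒n≤o N₄ M₅ (ℕ.m⊔n≤o⇒n≤o N₃ (N₄ ℕ.⊔ M₅) n≥M₃)
      n≥M₆ = ℕ.m⊔n≤o⇒n≤o N₅ (N₆ ℕ.⊔ N₇) n≥M₅
      a = seq ε n
      b = seq δ n
      α≤a = subst (ℚ._≤ a) (ℚ.+-identityˡ α) (α≤ε n (ℕ.m≤m⊔n N₁ (N₂ ℕ.⊔ M₃)))
      β≤b = subst (ℚ._≤ b) (ℚ.+-identityˡ β)
              (β≤δ n (ℕ.m⊔n≤o⇒m≤o N₂ M₃ (ℕ.m⊔n≤o⇒n≤o N₁ (N₂ ℕ.⊔ M₃) ℕ.≤-refl)))
      a≤1 = drop-pos {a} 0<γ (ε≤1 n (ℕ.m⊔n≤o⇒m≤o N₃ (N₄ ℕ.⊔ M₅) n≥M₃))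
      b≤1 = drop-pos {b} 0<ζ (δ≤1 n (ℕ.m⊔n≤o⇒m≤o N₄ M₅ (ℕ.m⊔n≤o⇒n≤o N₃ (N₄ ℕ.⊔ M₅) n≥M₃)))
  in record
    -- One `θ` absorbs the variation of each sequence beyond its threshold; the second `θ` in `D` is
    -- the margin in `δ+θ≤D`.
    { e = a ℚ.+ θ ; D = b ℚ.+ ι 2 ℚ.* θ ; θ = θ
    ; 0<e = ℚ.+-mono-< (ℚ.<-≤-trans 0<α α≤a) 0<θ
    ; 0<D = ℚ.+-mono-< (ℚ.<-≤-trans 0<β β≤b) (*-pos (0<ι 2) 0<θ)
    ; 0<θ = 0<θ
    ; ε≤e = N₆ , λ i i≥ → ∣p-q∣<θ⇒p≤q+θ (seq ε i) a (ε-close i n i≥ (ℕ.m⊔n≤o⇒m≤o N₆ N₇ n≥M₆))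
    ; δ+θ≤D = N₇ , λ i i≥ → subst (seq δ i ℚ.+ θ ℚ.≤_)
        (solve 2 (λ b θ → b :+ θ :+ θ := b :+ con (ι 2) :* θ) refl b θ)
        (ℚ.+-monoˡ-≤ θ (∣p-q∣<θ⇒p≤q+θ (seq δ i) b (δ-close i n i≥ (ℕ.m⊔n≤o⇒n≤o N₆ N₇ n≥M₆))))
    ; 8emD≤1 = perturbed-bound {u = 1/max 0<α a} {v = 1/max 0<β b} (1/max-inverseˡ 0<α α≤a) (1/max-inverseˡ 0<β β≤b)
        0<α 0<β (0≤ι m) 0<g 0<θ α≤a β≤b a≤1 b≤1 (hyp n (ℕ.m⊔n≤o⇒m≤o N₅ (N₆ ℕ.⊔ N₇) n≥M₅)) Bθ≡w
    }
  where
  drop-pos : ∀ {p q γ} → 0ℚ ℚ.< γ → p ℚ.+ γ ℚ.≤ q → p ℚ.≤ q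
  drop-pos {p} {q} {γ} 0<γ p+γ≤q = ℚ.≤-trans
    (subst (ℚ._≤ p ℚ.+ γ) (ℚ.+-identityʳ p) (ℚ.+-monoʳ-≤ p (ℚ.<⇒≤ 0<γ))) p+γ≤q

-- The two regimes and the choice of `K`

HasBadInstance : ∀ (d : ℕ) (ε δ : ℝ) (m : ℕ) .{{_ : NonZero m}} → Set₁
HasBadInstance d ε δ m = ∃[ k ] Σ[ A ∈ Vector (Point d) (suc k) ]
  Pr[ (λ (s : Sample (suc k) m) → ¬ IsApproxMean ε A (empiricalMean A s)) ]> δ

module _ (d m : ℕ) .{{d≢0 : NonZero d}} .{{m≢0 : NonZero m}} {ε δ : ℝ} (0<ε : 0ℝ < ε) (B : RationalBounds ε δ m) where

  open RationalBounds B

  private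
    2·2≡4 : ι 2 ℚ.* (ι 2 ℚ.* (e ℚ.* ι m)) ≡ ι 4 ℚ.* (e ℚ.* ι m)
    2·2≡4 = solve 1 (λ t → con (ι 2) :* (con (ι 2) :* t) := con (ι 4) :* t) refl (e ℚ.* ι m)

    multiple : ∀ K .{{_ : NonZero K}} → ∃[ k ] suc k ≡ K ℕ.* m
    multiple K = ℕ.pred (K ℕ.* m) , ℕ.suc-pred (K ℕ.* m) {{ℕ.m*n≢0 K m}}

    ι-multiple : ∀ {k} K → suc k ≡ K ℕ.* m → ι (suc k) ≡ ι K ℚ.* ι m
    ι-multiple K n≡Km = trans (cong ι n≡Km) (ι-* K m)

  -- With n = 2m every sample fails, whether or not it hits the spike.
  badInstance-small : δ < 1ℝ → ι 2 ℚ.* (e ℚ.* ι m) ℚ.≤ 1ℚ → HasBadInstance d ε δ m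
  badInstance-small δ<1 2em≤1 = build (multiple 2)
    where
    4em≤2 : ι 4 ℚ.* (e ℚ.* ι m) ℚ.≤ ι 2
    4em≤2 = subst (ℚ._≤ ι 2) 2·2≡4 (ℚ.*-monoˡ-≤-nonNeg (ι 2) 2em≤1)
    build : (∃[ k ] suc k ≡ 2 ℕ.* m) → HasBadInstance d ε δ m
    build (k , n≡2m) = k , spike d k , (λ _ → ⊤) , (λ _ → yes tt)
      , (λ {s} _ → spike-fails {k} {m} {2} {{m≢0}} (ι-multiple 2 n≡2m) {d} {{d≢0}} {ε} {e} 0<ε 0<e ε≤e s
                     ℚ.≤-refl 4em≤2 2em≤1)
      , subst (λ p → δ < fromℚ p) (sym (Pr-all (suc k) m)) δ<1

  -- With n = Km for K = ⌈4em⌉ ≥ 2 every sample hitting the spike fails, which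
  -- has probability at least 1/(K + 1) ≥ 1/(8em).
  badInstance-large : 1ℚ ℚ.≤ ι 2 ℚ.* (e ℚ.* ι m) → HasBadInstance d ε δ m
  badInstance-large 1≤2em = scaled (ceiling (ι 4 ℚ.* t) (ℚ.<-≤-trans (0<ι 2) 2≤4em))
    where
    t = e ℚ.* ι m
    2≤4em : ι 2 ℚ.≤ ι 4 ℚ.* t
    2≤4em = subst (ι 2 ℚ.≤_) 2·2≡4 (ℚ.*-monoˡ-≤-nonNeg (ι 2) 1≤2em)
    D[K+1]≤1 : ∀ {κ} → κ ℚ.≤ ι 4 ℚ.* t ℚ.+ 1ℚ → D ℚ.* (κ ℚ.+ 1ℚ) ℚ.≤ 1ℚ
    D[K+1]≤1 {κ} κ≤4em+1 = begin
      D ℚ.* (κ ℚ.+ 1ℚ)                     ≤⟨ ℚ.*-monoˡ-≤-nonNeg D {{ℚ.nonNegative (ℚ.<⇒≤ 0<D)}} (begin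
        κ ℚ.+ 1ℚ                           ≤⟨ ℚ.+-monoˡ-≤ 1ℚ κ≤4em+1 ⟩
        ι 4 ℚ.* t ℚ.+ 1ℚ ℚ.+ 1ℚ             ≡⟨ ℚ.+-assoc (ι 4 ℚ.* t) 1ℚ 1ℚ ⟩
        ι 4 ℚ.* t ℚ.+ ι 2                   ≤⟨ ℚ.+-monoʳ-≤ (ι 4 ℚ.* t) 2≤4em ⟩
        ι 4 ℚ.* t ℚ.+ ι 4 ℚ.* t              ≡⟨ solve 1 (λ t → con (ι 4) :* t :+ con (ι 4) :* t := con (ι 8) :* t) refl t ⟩
        ι 8 ℚ.* t                          ∎) ⟩
      D ℚ.* (ι 8 ℚ.* t)                    ≡⟨ ℚ.*-comm D (ι 8 ℚ.* t) ⟩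
      ι 8 ℚ.* t ℚ.* D                      ≤⟨ 8emD≤1 ⟩
      1ℚ                                   ∎
      where open ℚ.≤-Reasoning
    build : ∀ K .{{_ : NonZero K}} → ι 4 ℚ.* t ℚ.≤ ι K → ι K ℚ.≤ ι 4 ℚ.* t ℚ.+ 1ℚ →
            (∃[ k ] suc k ≡ K ℕ.* m) → HasBadInstance d ε δ m
    build K {{K≢0}} 4em≤K K≤4em+1 (k , n≡Km) = k , spike d k , Hits {k} {m} , hits? {k} {m}
      , (λ {s} → spike-fails-on-hit {k} {m} {K} {{m≢0}} {{K≢0}} (ι-multiple K n≡Km) {d} {{d≢0}} {ε} {e} 0<ε 0<e ε≤e s
                   (ℚ.≤-trans 2≤4em 4em≤K) 4em≤K)
      -- Eventually `δ + θ ≤ D`, and `D` is at most the probability of a hit.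
      , mk< θ 0<θ (proj₁ δ+θ≤D , λ i i≥ → ℚ.≤-trans (proj₂ δ+θ≤D i i≥)
          (Pr-hits-lower-bound {D} k m K n≡Km (ℚ.<⇒≤ 0<D) (D[K+1]≤1 K≤4em+1)))
    scaled : (∃[ K ] ι 4 ℚ.* t ℚ.≤ ι K × ι K ℚ.≤ ι 4 ℚ.* t ℚ.+ 1ℚ) → HasBadInstance d ε δ m
    -- The ceiling cannot be 0, because `4 e m ≥ 2` in this regime.
    scaled (ℕ.zero , 4em≤0 , _) = contradiction (ℚ.<-≤-trans (0<ι 2) (ℚ.≤-trans 2≤4em 4em≤0)) (ℚ.<-irrefl refl)
    scaled (suc K′ , 4em≤K , K≤4em+1) = build (suc K′) 4em≤K K≤4em+1 (multiple (suc K′))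

  badInstance : δ < 1ℝ → HasBadInstance d ε δ m
  badInstance δ<1 = choose (ι 2 ℚ.* (e ℚ.* ι m) ℚ.≤? 1ℚ)
    where
    choose : Dec (ι 2 ℚ.* (e ℚ.* ι m) ℚ.≤ 1ℚ) → HasBadInstance d ε δ m
    choose (yes 2em≤1) = badInstance-small δ<1 2em≤1
    choose (no  2em≰1) = badInstance-large (ℚ.<⇒≤ (ℚ.≰⇒> 2em≰1))

theorem5p2 : Σ[ c ∈ ℝ ] 0ℝ < c ×
    (∀ (d : ℕ) .{{_ : NonZero d}}
    (ε δ : ℝ) (0<ε : 0ℝ < ε) (ε<1 : ε < 1ℝ) (0<δ : 0ℝ < δ) (δ<1 : δ < 1ℝ)
    (m : ℕ) .{{_ : NonZero m}} →
    fromℕ m < c * inv ε 0<ε * inv δ 0<δ →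
    ∃[ k ] Σ[ A ∈ Vector (Point d) (suc k) ]
    Pr[ (λ (s : Sample (suc k) m) → ¬ IsApproxMean ε A (empiricalMean A s)) ]> δ)
theorem5p2 = fromℚ ⅛
  , mk< ⅛ (ℚ.positive⁻¹ ⅛) (0 , λ _ _ → ℚ.≤-reflexive (ℚ.+-identityˡ ⅛))
  , λ d {{d≢0}} ε δ 0<ε ε<1 0<δ δ<1 m {{m≢0}} m<c/εδ →
      badInstance d m {{d≢0}} {{m≢0}} {ε} {δ} 0<ε (rationalBounds {ε} {δ} 0<ε 0<δ ε<1 δ<1 m m<c/εδ) δ<1
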